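{- Let $n\ge1$. There is a coupling $(W_n,U_n)$, i.e. a probability distribution on $\mathcal{W}_n\times\mathcal{U}_n$ whose marginals are the uniform distribution on $\mathcal W_n$ (law of $W_n$) and the uniform distribution on $\mathcal U_n$ (law of $U_n$), such that, with probability one, for all $k$, \[ \widehat\Lambda_{k-2}^{(n)}\;\leq\;\widehat\lambda_k^{(n)}\;\leq\;\widehat\Lambda_{k+2}^{(n)}, \] and in particular \[ |\mu_n-(M_n-m_n)|\leq3 . \]
   Context: A plane tree is a rooted tree in which the children of each vertex are linearly ordered. An embedded tree is a plane tree whose vertices carry integer labels such that the labels of adjacent vertices differ by at most $1$ and the root vertex has label $1$. $\mathcal U_n$ is the set of embedded trees with $n$ edges, and $\mathcal W_n\subset\mathcal U_n$ is the subset of well labelled trees, i.e. those all of whose labels are positive. For a labelled tree $T$ let $\lambda_k^{[T]}$ be its number of vertices with label $k$. For the random trees: $\widehat\lambda^{(n)}_k=\sum_{\ell=1}^k\lambda_\ell^{[W_n]}$; $m_n$ and $M_n$ are the minimal and maximal labels of $U_n$; $\widehat\Lambda_k^{(n)}=\sum_{\ell=1}^k\lambda^{[U_n]}_{m_n+\ell-1}$; $\mu_n$ is the maximal label of $W_n$. Empty sums are $0$. -}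

module Defs where

open import Axiom.UniquenessOfIdentityProofs using (module Decidable⇒UIP)
open import Data.Bool.Base using (Bool; T)
open import Data.Integer.Base as ℤ using (ℤ; +_; -[1+_]; 0ℤ; 1ℤ)
import Data.Integer.Properties as ℤ
open import Data.List.Base using (List; []; _∷_; _++_; foldr; map; filter; filterᵇ; length; upTo)
open import Data.List.Extrema ℤ.≤-totalOrder using (min; max)
open import Data.List.Relation.Unary.All as All using (All; []; _∷_)
open import Data.Nat.Base as ℕ using (ℕ; suc)
open import Data.Nat.ListAction using (sum)
import Data.Nat.Properties as ℕ
open import Data.Product.Base using (Σ-syntax; _×_; _,_; proj₁; proj₂)
open import Data.Rational.Base as ℚ using (ℚ; 0ℚ; 1ℚ)
open import Relation.Binary.Definitions using (DecidableEquality)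
open import Relation.Binary.PropositionalEquality using (_≡_; refl; cong; cong₂)
open import Relation.Nullary.Decidable using (yes; no; does; map′; _×-dec_)
open import Relation.Nullary.Irrelevant using (Irrelevant)

------------------------------------------------------------------------
-- Labelled plane trees

data Tree : Set where
  node : (label : ℤ) (children : List Tree) → Tree

rootLabel : Tree → ℤ
rootLabel (node x _) = x

mutual
  edges : Tree → ℕ
  edges (node _ ts) = edgesᶠ ts

  -- Includes the edges joining the trees of the forest to their common parent.
  edgesᶠ : List Tree → ℕ
  edgesᶠ []       = 0
  edgesᶠ (t ∷ ts) = suc (edges t) ℕ.+ edgesᶠ ts

-- One entry per vertex, in preorder.
mutual
  labels : Tree → List ℤ
  labels (node x ts) = x ∷ labelsᶠ ts

  labelsᶠ : List Tree → List ℤ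
  labelsᶠ []       = []
  labelsᶠ (t ∷ ts) = labels t ++ labelsᶠ ts

data AdjacentDifferByAtMost1 : Tree → Set where
  node : ∀ {x ts} →
         All (λ t → ℤ.∣ x ℤ.- rootLabel t ∣ ℕ.≤ 1) ts →
         All AdjacentDifferByAtMost1 ts →
         AdjacentDifferByAtMost1 (node x ts)

record 𝒰 (n : ℕ) : Set where
  constructor mk𝒰
  field
    tree     : Tree
    edges≡n  : edges tree ≡ n
    root≡1   : rootLabel tree ≡ 1ℤ
    adjacent : AdjacentDifferByAtMost1 tree

record 𝒲 (n : ℕ) : Set where
  constructor mk𝒲
  field
    embedded : 𝒰 n
    positive : All (0ℤ ℤ.<_) (labels (𝒰.tree embedded))

-- The membership conditions are propositions, so elements of 𝒰 n and of 𝒲 n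
-- are equal exactly when their underlying trees are.

mutual
  adjacent-irrelevant : ∀ {t} → Irrelevant (AdjacentDifferByAtMost1 t)
  adjacent-irrelevant (node ps as) (node qs bs) =
    cong₂ node (All.irrelevant ℕ.≤-irrelevant ps qs) (adjacentᶠ-irrelevant as bs)

  adjacentᶠ-irrelevant : ∀ {ts} → Irrelevant (All AdjacentDifferByAtMost1 ts)
  adjacentᶠ-irrelevant []       []       = refl
  adjacentᶠ-irrelevant (a ∷ as) (b ∷ bs) =
    cong₂ _∷_ (adjacent-irrelevant a b) (adjacentᶠ-irrelevant as bs)

𝒰-ext : ∀ {n} {u v : 𝒰 n} → 𝒰.tree u ≡ 𝒰.tree v → u ≡ v
𝒰-ext {u = mk𝒰 _ e r a} {v = mk𝒰 _ e′ r′ a′} refl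
  with refl ← ℕ.≡-irrelevant e e′
     | refl ← Decidable⇒UIP.≡-irrelevant ℤ._≟_ r r′
     | refl ← adjacent-irrelevant a a′ = refl

𝒲-ext : ∀ {n} {w v : 𝒲 n} → 𝒲.embedded w ≡ 𝒲.embedded v → w ≡ v
𝒲-ext {w = mk𝒲 _ p} {v = mk𝒲 _ q} refl
  with refl ← All.irrelevant ℤ.<-irrelevant p q = refl

mutual
  _≟ᵗ_ : DecidableEquality Tree
  node x ss ≟ᵗ node y ts =
    map′ (λ { (refl , refl) → refl }) (λ { refl → refl , refl })
         (x ℤ.≟ y ×-dec ss ≟ᶠ ts)

  _≟ᶠ_ : DecidableEquality (List Tree)
  []       ≟ᶠ []       = yes refl
  []       ≟ᶠ (_ ∷ _)  = no λ ()
  (_ ∷ _)  ≟ᶠ []       = no λ ()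
  (s ∷ ss) ≟ᶠ (t ∷ ts) =
    map′ (λ { (refl , refl) → refl }) (λ { refl → refl , refl })
         (s ≟ᵗ t ×-dec ss ≟ᶠ ts)

_≟ᵘ_ : ∀ {n} → DecidableEquality (𝒰 n)
u ≟ᵘ v = map′ 𝒰-ext (cong 𝒰.tree) (𝒰.tree u ≟ᵗ 𝒰.tree v)

_≟ʷ_ : ∀ {n} → DecidableEquality (𝒲 n)
w ≟ʷ v = map′ 𝒲-ext (cong 𝒲.embedded) (𝒲.embedded w ≟ᵘ 𝒲.embedded v)

------------------------------------------------------------------------
-- Label statistics

-- λ_k^{[T]}
vertices : Tree → ℤ → ℕ
vertices t k = length (filter (ℤ._≟ k) (labels t))

-- The default value passed to min and max is itself one of the labels.
minLabel : Tree → ℤ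
minLabel t = min (rootLabel t) (labels t)

maxLabel : Tree → ℤ
maxLabel t = max (rootLabel t) (labels t)

-- Σ_{ℓ=1}^{k} f(ℓ), which is empty for k ≤ 0.
∑₁ : ℤ → (ℤ → ℕ) → ℕ
∑₁ (+ k)    f = sum (map (λ i → f (+ suc i)) (upTo k))
∑₁ -[1+ _ ] f = 0

module _ {n : ℕ} where

  λ̂ : 𝒲 n → ℤ → ℕ
  λ̂ w k = ∑₁ k λ ℓ → vertices (𝒰.tree (𝒲.embedded w)) ℓ

  μ : 𝒲 n → ℤ
  μ w = maxLabel (𝒰.tree (𝒲.embedded w))

  m M : 𝒰 n → ℤ
  m u = minLabel (𝒰.tree u)
  M u = maxLabel (𝒰.tree u)

  Λ̂ : 𝒰 n → ℤ → ℕ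
  Λ̂ u k = ∑₁ k λ ℓ → vertices (𝒰.tree u) (m u ℤ.+ ℓ ℤ.- 1ℤ)

------------------------------------------------------------------------
-- Finitely supported probability distributions

mass : ∀ {Ω : Set} → List (Ω × ℚ) → ℚ
mass xs = foldr ℚ._+_ 0ℚ (map proj₂ xs)

-- A finite weighted sum of point masses; an outcome may be listed repeatedly,
-- in which case its weights add up.
record Distribution (Ω : Set) : Set where
  field
    atoms       : List (Ω × ℚ)
    nonNegative : All (λ a → 0ℚ ℚ.≤ proj₂ a) atoms
    total       : mass atoms ≡ 1ℚ

ℙ : ∀ {Ω : Set} → Distribution Ω → (Ω → Bool) → ℚ
ℙ P A = mass (filterᵇ (λ a → A (proj₁ a)) (Distribution.atoms P))

-- The law of X is uniform on its whole codomain: all values are equally likely.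
-- As P has finite support and total mass 1, this forces the codomain to be
-- finite, every value having probability 1 / (number of values).
HasUniformLaw : ∀ {Ω B : Set} → DecidableEquality B →
                Distribution Ω → (Ω → B) → Set
HasUniformLaw _≟_ P X =
  ∀ x y → ℙ P (λ ω → does (X ω ≟ x)) ≡ ℙ P (λ ω → does (X ω ≟ y))

-- E contains a decidable event of probability one; E itself need not be
-- presented by a decision procedure.
AlmostSurely : ∀ {Ω : Set} → Distribution Ω → (Ω → Set) → Set
AlmostSurely {Ω} P E =
  Σ[ A ∈ (Ω → Bool) ] (ℙ P A ≡ 1ℚ × (∀ ω → T (A ω) → E ω))

record IsCoupling {n : ℕ} (P : Distribution (𝒲 n × 𝒰 n)) : Set where
  field
    uniform-𝒲 : HasUniformLaw _≟ʷ_ P proj₁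
    uniform-𝒰 : HasUniformLaw _≟ᵘ_ P proj₂

{-# OPTIONS --safe #-}

-- An embedded tree is encoded by a blossom tree: a planted binary tree each of
-- whose n inner vertices carries one bud.  Read the contour of the blossom tree
-- as a walk started at height 1 which goes up at each leaf and down at each bud;
-- the heights at which the n + 1 non-root leaves are met are the labels of the
-- embedded tree.  Counting the root leaf as a last up step, the walk gains 2 per
-- turn.  Moving the root to another leaf rotates this closed walk, so it shifts
-- the heights on either side of that leaf by constants which differ by 2.  The
-- rerooted tree is well labelled exactly when the new root leaf is the last
-- passage of the walk at its minimal height m or at m + 1 (cycle lemma), so each
-- blossom tree has exactly two good leaves, while each well labelled tree is
-- reached from n + 2 pairs (tree, good leaf).  The uniform law on these pairs
-- is the coupling.

module Submission where

open import Defs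
open import Data.Nat using (ℕ; _≤_)
open import Data.Integer using (ℤ; +_; _+_; _-_; ∣_∣)
open import Data.Product using (Σ-syntax; _×_; _,_)

open import Algebra.Bundles using (CommutativeRing)
import Algebra.Properties.Semiring.Mult as Mult
open import Data.Bool.Base using (Bool; true; false)
open import Data.Integer as ℤ using (0ℤ; 1ℤ; -1ℤ)
import Data.Integer.Properties as ℤ
open import Data.Integer.Tactic.RingSolver using (solve-∀)
open import Data.List.Base
  using (List; []; _∷_; [_]; _++_; map; filter; length; reverse; upTo; concatMap;
         cartesianProduct; cartesianProductWith)
open import Data.List.Extrema ℤ.≤-totalOrder
  using (min≤⊤; min≤xs; argmin-sel; xs≤max; argmax-sel)
open import Data.List.Membership.DecPropositional using () renaming (_∈?_ to member?)
open import Data.List.Membership.Propositional using (_∈_)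
open import Data.List.Membership.Propositional.Properties
  using (∈-map⁺; ∈-map⁻; ∈-++⁺ˡ; ∈-++⁺ʳ; ∈-filter⁺; ∈-filter⁻; ∈-concatMap⁺; ∈-concatMap⁻;
         ∈-cartesianProduct⁺; ∈-cartesianProductWith⁺; ∈-cartesianProductWith⁻)
open import Data.List.Membership.Propositional.Properties.WithK using (unique∧set⇒bag)
import Data.List.Properties as List
open import Data.List.Relation.Binary.BagAndSetEquality using (∼bag⇒↭)
open import Data.List.Relation.Binary.Disjoint.Propositional using (Disjoint)
open import Data.List.Relation.Binary.Permutation.Propositional
  using (_↭_; ↭-refl; ↭-sym; ↭-trans; ↭-reflexive)
import Data.List.Relation.Binary.Permutation.Propositional.Properties as Perm
open import Data.List.Relation.Binary.Pointwise as Pointwise using (Pointwise; []; _∷_)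
open import Data.List.Relation.Unary.All as All using (All; []; _∷_)
import Data.List.Relation.Unary.All.Properties as All
open import Data.List.Relation.Unary.Any as Any using (here; there)
open import Data.List.Relation.Unary.Unique.Propositional using (Unique; []; _∷_)
import Data.List.Relation.Unary.Unique.Propositional.Properties as Unique
import Data.Nat.Base as ℕ
open import Data.Nat.ListAction using (sum)
open import Data.Nat.ListAction.Properties using (sum-↭; sum-++)
import Data.Nat.Properties as ℕ
open import Data.Product.Base using (proj₁; proj₂; map₁; map₂)
import Data.Product.Properties as Product
open import Data.Rational.Base as ℚ using (ℚ; 0ℚ; 1ℚ)
import Data.Rational.Properties as ℚ
open import Data.Sum.Base using (_⊎_; inj₁; inj₂; [_,_]′)
open import Function.Base using (_∘_; id)
open import Function.Bundles using (mk⇔)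
open import Level using (0ℓ)
open import Relation.Binary.Definitions using (DecidableEquality)
open import Relation.Binary.PropositionalEquality
  using (_≡_; _≢_; refl; sym; trans; cong; cong₂; subst; subst₂; module ≡-Reasoning)
open import Relation.Nullary.Decidable
  using (Dec; yes; no; does; isYes; T?; toWitness; fromWitness; _×-dec_)
open import Relation.Nullary.Negation using (¬_; contradiction)
open import Relation.Unary using (Pred; Decidable)

open Mult (CommutativeRing.semiring ℚ.+-*-commutativeRing)
  using (×-assoc-*) renaming (_×_ to _·_)

-- Counting

#_ : {A : Set} {P : Pred A 0ℓ} → Decidable P → List A → ℕ
(# P?) xs = length (filter P? xs)

module _ {A : Set} {P : Pred A 0ℓ} (P? : Decidable P) where

  #-map : {B : Set} (f : B → A) (xs : List B) → (# P?) (map f xs) ≡ (# (P? ∘ f)) xs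
  #-map f []       = refl
  #-map f (x ∷ xs) with does (P? (f x))
  ... | true  = cong ℕ.suc (#-map f xs)
  ... | false = #-map f xs

  #-accept : ∀ {x} xs → P x → (# P?) (x ∷ xs) ≡ ℕ.suc ((# P?) xs)
  #-accept xs px = cong length (List.filter-accept P? px)

  #-reject : ∀ {x} xs → ¬ P x → (# P?) (x ∷ xs) ≡ (# P?) xs
  #-reject xs ¬px = cong length (List.filter-reject P? ¬px)

-- Stated at a single point, because the decomposition behind the cycle lemma holds only for the
-- splits of one given word.
record DisjointUnion {A : Set} (P Q R : Pred A 0ℓ) (x : A) : Set where
  field
    split    : R x → P x ⊎ Q x
    inˡ      : P x → R x
    inʳ      : Q x → R x
    disjoint : P x → ¬ Q x

module _ {A : Set} {P Q R : Pred A 0ℓ}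
         (P? : Decidable P) (Q? : Decidable Q) (R? : Decidable R) where

  open DisjointUnion

  #-⊎ : ∀ {xs} → All (DisjointUnion P Q R) xs → (# R?) xs ≡ (# P?) xs ℕ.+ (# Q?) xs
  #-⊎ {[]}     []       = refl
  #-⊎ {x ∷ xs} (d ∷ ds) with P? x | Q? x
  ... | yes p | yes q = contradiction q (disjoint d p)
  ... | yes p | no  _ = trans (#-accept R? xs (inˡ d p)) (cong ℕ.suc (#-⊎ ds))
  ... | no  _ | yes q = trans (#-accept R? xs (inʳ d q))
                          (trans (cong ℕ.suc (#-⊎ ds)) (sym (ℕ.+-suc _ _)))
  ... | no ¬p | no ¬q = trans (#-reject R? xs ([ ¬p , ¬q ]′ ∘ split d)) (#-⊎ ds)

-- Walks

data Step : Set where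
  up down : Step

Word : Set
Word = List Step

rise : ℤ → Word → ℤ
rise h []         = h
rise h (up ∷ w)   = rise (1ℤ + h) w
rise h (down ∷ w) = rise (-1ℤ + h) w

-- The heights from which the up steps start.
ups : ℤ → Word → List ℤ
ups h []         = []
ups h (up ∷ w)   = h ∷ ups (1ℤ + h) w
ups h (down ∷ w) = ups (-1ℤ + h) w

rise-++ : ∀ h v w → rise h (v ++ w) ≡ rise (rise h v) w
rise-++ h []         w = refl
rise-++ h (up ∷ v)   w = rise-++ (1ℤ + h) v w
rise-++ h (down ∷ v) w = rise-++ (-1ℤ + h) v w

ups-++ : ∀ h v w → ups h (v ++ w) ≡ ups h v ++ ups (rise h v) w
ups-++ h []         w = refl
ups-++ h (up ∷ v)   w = cong (h ∷_) (ups-++ (1ℤ + h) v w)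
ups-++ h (down ∷ v) w = ups-++ (-1ℤ + h) v w

rise-shift : ∀ h d w → rise (h + d) w ≡ rise h w + d
rise-shift h d []         = refl
rise-shift h d (up ∷ w)   =
  trans (cong (λ x → rise x w) (sym (ℤ.+-assoc 1ℤ h d))) (rise-shift (1ℤ + h) d w)
rise-shift h d (down ∷ w) =
  trans (cong (λ x → rise x w) (sym (ℤ.+-assoc -1ℤ h d))) (rise-shift (-1ℤ + h) d w)

ups-shift : ∀ h d w → ups (h + d) w ≡ map (_+ d) (ups h w)
ups-shift h d []         = refl
ups-shift h d (up ∷ w)   = cong (h + d ∷_)
  (trans (cong (λ x → ups x w) (sym (ℤ.+-assoc 1ℤ h d))) (ups-shift (1ℤ + h) d w))
ups-shift h d (down ∷ w) =
  trans (cong (λ x → ups x w) (sym (ℤ.+-assoc -1ℤ h d))) (ups-shift (-1ℤ + h) d w)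

-- At height at most `c` the hypothesis forbids up steps, so the walk can only descend from there.
stays-low : ∀ c h w → All (c ℤ.<_) (ups h w) → h ℤ.≤ c → rise h w ℤ.≤ c
stays-low c h []         _         h≤c = h≤c
stays-low c h (up ∷ w)   (c<h ∷ _) h≤c = contradiction h≤c (ℤ.<⇒≱ c<h)
stays-low c h (down ∷ w) c<        h≤c =
  stays-low c (-1ℤ + h) w c< (ℤ.≤-trans (ℤ.i≤j⇒pred[i]≤j ℤ.≤-refl) h≤c)

-- Cutting a walk at an up step; last passages.

splits : Word → List (Word × Word)
splits []         = []
splits (up ∷ w)   = ([] , w) ∷ map (map₁ (up ∷_)) (splits w)
splits (down ∷ w) = map (map₁ (down ∷_)) (splits w)

splits-rejoin : ∀ f → All (λ (v , v′) → f ≡ v ++ up ∷ v′) (splits f)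
splits-rejoin []         = []
splits-rejoin (up ∷ w)   = refl ∷ All.map⁺ (All.map (cong (up ∷_)) (splits-rejoin w))
splits-rejoin (down ∷ w) = All.map⁺ (All.map (cong (down ∷_)) (splits-rejoin w))

splits-++ : ∀ v w → splits (v ++ w) ≡
            map (map₂ (_++ w)) (splits v) ++ map (map₁ (v ++_)) (splits w)

splits-++-∷ : ∀ s v w → map (map₁ (s ∷_)) (splits (v ++ w)) ≡
              map (map₂ (_++ w)) (map (map₁ (s ∷_)) (splits v)) ++
              map (map₁ ((s ∷ v) ++_)) (splits w)

splits-++ []         w = sym (List.map-id _)
splits-++ (up ∷ v)   w = cong (([] , v ++ w) ∷_) (splits-++-∷ up v w)
splits-++ (down ∷ v) w = splits-++-∷ down v w

splits-++-∷ s v w = begin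
  map (map₁ (s ∷_)) (splits (v ++ w))
    ≡⟨ cong (map _) (splits-++ v w) ⟩
  map (map₁ (s ∷_)) (map (map₂ (_++ w)) (splits v) ++ map (map₁ (v ++_)) (splits w))
    ≡⟨ List.map-++ _ (map (map₂ (_++ w)) (splits v)) _ ⟩
  map (map₁ (s ∷_)) (map (map₂ (_++ w)) (splits v)) ++
  map (map₁ (s ∷_)) (map (map₁ (v ++_)) (splits w))
    ≡⟨ cong₂ _++_ (trans (sym (List.map-∘ (splits v))) (List.map-∘ (splits v)))
                  (sym (List.map-∘ (splits w))) ⟩
  map (map₂ (_++ w)) (map (map₁ (s ∷_)) (splits v)) ++
  map (map₁ ((s ∷ v) ++_)) (splits w) ∎
  where open ≡-Reasoning

-- The removed up step is the last passage of the walk at height `c`. The second part begins at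
-- `1ℤ + c`, where that step ends.
LastAt : ℤ → ℤ → Pred (Word × Word) 0ℓ
LastAt c h (v , v′) = rise h v ≡ c × All (c ℤ.<_) (ups (1ℤ + c) v′)

lastAt? : ∀ c h → Decidable (LastAt c h)
lastAt? c h (v , v′) = rise h v ℤ.≟ c ×-dec All.all? (c ℤ.<?_) (ups (1ℤ + c) v′)

#-lastAt≡0 : ∀ c h w → All (c ℤ.<_) (ups h w) → (# lastAt? c h) (splits w) ≡ 0
#-lastAt≡0 c h []         _          = refl
#-lastAt≡0 c h (up ∷ w)   (c<h ∷ c<) =
  trans (#-reject (lastAt? c h) {[] , w} _ λ (h≡c , _) → ℤ.<-irrefl (sym h≡c) c<h)
  (trans (#-map (lastAt? c h) (map₁ (up ∷_)) (splits w)) (#-lastAt≡0 c (1ℤ + h) w c<))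
#-lastAt≡0 c h (down ∷ w) c<         =
  trans (#-map (lastAt? c h) (map₁ (down ∷_)) (splits w)) (#-lastAt≡0 c (-1ℤ + h) w c<)

-- A discrete intermediate value argument. Some up step starts at height at most `c`; the last such
-- step must start exactly at `c`, since otherwise it ends at height at most `c` and `stays-low`
-- keeps the walk from ending above `c`.
#-lastAt≡1 : ∀ c h w → c ℤ.< rise h w → ¬ All (c ℤ.<_) (ups h w) →
             (# lastAt? c h) (splits w) ≡ 1
#-lastAt≡1 c h []         c<end ¬c< = contradiction [] ¬c<
#-lastAt≡1 c h (down ∷ w) c<end ¬c< =
  trans (#-map (lastAt? c h) (map₁ (down ∷_)) (splits w)) (#-lastAt≡1 c (-1ℤ + h) w c<end ¬c<)
#-lastAt≡1 c h (up ∷ w)   c<end ¬c< = by-cases (All.all? (c ℤ.<?_) (ups (1ℤ + h) w)) (h ℤ.≟ c)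
  where
  #-tail : (# lastAt? c h) (map (map₁ (up ∷_)) (splits w)) ≡ (# lastAt? c (1ℤ + h)) (splits w)
  #-tail = #-map (lastAt? c h) (map₁ (up ∷_)) (splits w)

  by-cases : Dec (All (c ℤ.<_) (ups (1ℤ + h) w)) → Dec (h ≡ c) →
             (# lastAt? c h) (splits (up ∷ w)) ≡ 1
  by-cases (yes c<) (yes refl) =
    trans (#-accept (lastAt? c h) {[] , w} _ (refl , c<))
          (cong ℕ.suc (trans #-tail (#-lastAt≡0 c (1ℤ + h) w c<)))
  by-cases (yes c<) (no h≢c) = contradiction
    (stays-low c (1ℤ + h) w c<
      (ℤ.i<j⇒suc[i]≤j (ℤ.≤∧≢⇒< (ℤ.≮⇒≥ λ c<h → ¬c< (c<h ∷ c<)) h≢c)))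
    (ℤ.<⇒≱ c<end)
  by-cases (no ¬c<′) _ =
    trans (#-reject (lastAt? c h) {[] , w} _ λ { (refl , c<) → ¬c<′ c< })
          (trans #-tail (#-lastAt≡1 c (1ℤ + h) w c<end ¬c<′))

-- Blossom trees

-- The position of the bud among the three children of a vertex (first, second,
-- third); the names refer to labels, see forest.
data Kind : Set where
  low mid high : Kind

data Blossom : Set where
  leaf : Blossom
  node : Kind → (l r : Blossom) → Blossom

size : Blossom → ℕ
size leaf         = 0
size (node _ l r) = ℕ.suc (size l ℕ.+ size r)

bud₁ bud₂ bud₃ : Kind → Word
bud₁ low  = down ∷ []
bud₁ mid  = []
bud₁ high = []
bud₂ low  = []
bud₂ mid  = down ∷ []
bud₂ high = []
bud₃ low  = []
bud₃ mid  = []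
bud₃ high = down ∷ []

word : Blossom → Word
word leaf         = up ∷ []
word (node k l r) = bud₁ k ++ word l ++ bud₂ k ++ word r ++ bud₃ k

-- A vertex on the path from the root to a leaf, with the subtree which hangs off
-- the path to its left (ˡ) or right (ʳ).
data Frame : Set where
  subtreeˡ subtreeʳ : Kind → Blossom → Frame

before after : Frame → Word
before (subtreeˡ k l) = bud₁ k ++ word l ++ bud₂ k
before (subtreeʳ k r) = bud₁ k
after (subtreeˡ k l)  = bud₃ k
after (subtreeʳ k r)  = bud₂ k ++ word r ++ bud₃ k

-- The same vertex seen by a path which traverses it in the opposite direction:
-- its left and right sides are exchanged, hence the cyclic shift of the bud.
flip : Frame → Frame
flip (subtreeˡ low  t) = subtreeʳ mid  t
flip (subtreeˡ mid  t) = subtreeʳ high t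
flip (subtreeˡ high t) = subtreeʳ low  t
flip (subtreeʳ low  t) = subtreeˡ high t
flip (subtreeʳ mid  t) = subtreeˡ low  t
flip (subtreeʳ high t) = subtreeˡ mid  t

flip-involutive : ∀ f → flip (flip f) ≡ f
flip-involutive (subtreeˡ low  t) = refl
flip-involutive (subtreeˡ mid  t) = refl
flip-involutive (subtreeˡ high t) = refl
flip-involutive (subtreeʳ low  t) = refl
flip-involutive (subtreeʳ mid  t) = refl
flip-involutive (subtreeʳ high t) = refl

before-flip : ∀ f → before (flip f) ≡ after f
before-flip (subtreeˡ low  t) = refl
before-flip (subtreeˡ mid  t) = refl
before-flip (subtreeˡ high t) = refl
before-flip (subtreeʳ low  t) = refl
before-flip (subtreeʳ mid  t) = refl
before-flip (subtreeʳ high t) = refl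

-- Paths to a leaf and their reversal.

Path : Set
Path = List Frame

plug : Path → Blossom
plug []                  = leaf
plug (subtreeˡ k l ∷ fs) = node k l (plug fs)
plug (subtreeʳ k r ∷ fs) = node k (plug fs) r

-- Frames are listed from the root to the leaf. What lies to the right of the path is met on the way
-- back, hence the opposite order in `afters`.
befores afters : Path → Word
befores []       = []
befores (f ∷ fs) = before f ++ befores fs
afters []        = []
afters (f ∷ fs)  = afters fs ++ after f

befores-++ : ∀ fs gs → befores (fs ++ gs) ≡ befores fs ++ befores gs
befores-++ []       gs = refl
befores-++ (f ∷ fs) gs = trans (cong (before f ++_) (befores-++ fs gs))
                               (sym (List.++-assoc (before f) _ _))

afters-++ : ∀ fs gs → afters (fs ++ gs) ≡ afters gs ++ afters fs
afters-++ []       gs = sym (List.++-identityʳ _)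
afters-++ (f ∷ fs) gs = trans (cong (_++ after f) (afters-++ fs gs))
                              (List.++-assoc (afters gs) _ _)

backwards : Path → Path
backwards fs = reverse (map flip fs)

backwards-∷ : ∀ f fs → backwards (f ∷ fs) ≡ backwards fs ++ [ flip f ]
backwards-∷ f fs = List.unfold-reverse (flip f) (map flip fs)

backwards-involutive : ∀ fs → backwards (backwards fs) ≡ fs
backwards-involutive fs = begin
  reverse (map flip (reverse (map flip fs))) ≡⟨ cong reverse (List.reverse-map flip (map flip fs)) ⟩
  reverse (reverse (map flip (map flip fs))) ≡⟨ List.reverse-involutive _ ⟩
  map flip (map flip fs)                     ≡⟨ List.map-∘ fs ⟨
  map (flip ∘ flip) fs                       ≡⟨ List.map-cong flip-involutive fs ⟩
  map id fs                                  ≡⟨ List.map-id fs ⟩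
  fs                                         ∎
  where open ≡-Reasoning

-- Flipping a frame exchanges its sides, and reversing the path produces the order from leaf to root
-- in which `afters` already collects them.
befores-backwards : ∀ fs → befores (backwards fs) ≡ afters fs
befores-backwards []       = refl
befores-backwards (f ∷ fs) = begin
  befores (backwards (f ∷ fs))           ≡⟨ cong befores (backwards-∷ f fs) ⟩
  befores (backwards fs ++ [ flip f ])   ≡⟨ befores-++ (backwards fs) _ ⟩
  befores (backwards fs) ++ (before (flip f) ++ [])
    ≡⟨ cong₂ _++_ (befores-backwards fs) (trans (List.++-identityʳ _) (before-flip f)) ⟩
  afters fs ++ after f                   ∎
  where open ≡-Reasoning

afters-backwards : ∀ fs → afters (backwards fs) ≡ befores fs
afters-backwards fs =
  trans (sym (befores-backwards (backwards fs))) (cong befores (backwards-involutive fs))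

frameSize : Frame → ℕ
frameSize (subtreeˡ k l) = ℕ.suc (size l)
frameSize (subtreeʳ k r) = ℕ.suc (size r)

frameSize-flip : ∀ f → frameSize (flip f) ≡ frameSize f
frameSize-flip (subtreeˡ low  t) = refl
frameSize-flip (subtreeˡ mid  t) = refl
frameSize-flip (subtreeˡ high t) = refl
frameSize-flip (subtreeʳ low  t) = refl
frameSize-flip (subtreeʳ mid  t) = refl
frameSize-flip (subtreeʳ high t) = refl

-- A sum over the frames is blind to their order, and `flip` preserves each term; this makes the
-- size invariant under rerooting.
size-plug : ∀ fs → size (plug fs) ≡ sum (map frameSize fs)
size-plug []                  = refl
size-plug (subtreeˡ k l ∷ fs) = cong (λ s → ℕ.suc (size l ℕ.+ s)) (size-plug fs)
size-plug (subtreeʳ k r ∷ fs) =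
  cong ℕ.suc (trans (ℕ.+-comm _ (size r)) (cong (size r ℕ.+_) (size-plug fs)))

size-plug-backwards : ∀ fs → size (plug (backwards fs)) ≡ size (plug fs)
size-plug-backwards fs = begin
  size (plug (backwards fs))                    ≡⟨ size-plug (backwards fs) ⟩
  sum (map frameSize (reverse (map flip fs)))   ≡⟨ cong sum (List.reverse-map frameSize (map flip fs)) ⟩
  sum (reverse (map frameSize (map flip fs)))   ≡⟨ sum-↭ (Perm.↭-reverse (map frameSize (map flip fs))) ⟩
  sum (map frameSize (map flip fs))             ≡⟨ cong sum (List.map-∘ fs) ⟨
  sum (map (frameSize ∘ flip) fs)               ≡⟨ cong sum (List.map-cong frameSize-flip fs) ⟩
  sum (map frameSize fs)                        ≡⟨ size-plug fs ⟨
  size (plug fs)                                ∎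
  where open ≡-Reasoning

paths : Blossom → List Path
paths leaf         = [ [] ]
paths (node k l r) = map (subtreeʳ k r ∷_) (paths l) ++ map (subtreeˡ k l ∷_) (paths r)

plug-paths : ∀ T → All (λ fs → plug fs ≡ T) (paths T)
plug-paths leaf         = refl ∷ []
plug-paths (node k l r) =
  All.++⁺ (All.map⁺ (All.map (cong λ t → node k t r) (plug-paths l)))
          (All.map⁺ (All.map (cong (node k l)) (plug-paths r)))

∈-paths : ∀ fs → fs ∈ paths (plug fs)
∈-paths []                  = here refl
∈-paths (subtreeˡ k l ∷ fs) = ∈-++⁺ʳ (map (subtreeʳ k (plug fs) ∷_) (paths l)) (∈-map⁺ _ (∈-paths fs))
∈-paths (subtreeʳ k r ∷ fs) = ∈-++⁺ˡ (∈-map⁺ _ (∈-paths fs))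

paths-unique : ∀ T → Unique (paths T)
paths-unique leaf         = [] ∷ []
paths-unique (node k l r) =
  Unique.++⁺ (Unique.map⁺ List.∷-injectiveʳ (paths-unique l))
             (Unique.map⁺ List.∷-injectiveʳ (paths-unique r))
             disjoint
  where
  disjoint : Disjoint (map (subtreeʳ k r ∷_) (paths l)) (map (subtreeˡ k l ∷_) (paths r))
  disjoint (p , q) with _ , _ , refl ← ∈-map⁻ _ p with _ , _ , () ← ∈-map⁻ _ q

length-paths : ∀ T → length (paths T) ≡ ℕ.suc (size T)
length-paths leaf         = refl
length-paths (node k l r) = begin
  length (map (subtreeʳ k r ∷_) (paths l) ++ map (subtreeˡ k l ∷_) (paths r))
    ≡⟨ List.length-++ (map (subtreeʳ k r ∷_) (paths l)) ⟩
  length (map (subtreeʳ k r ∷_) (paths l)) ℕ.+ length (map (subtreeˡ k l ∷_) (paths r))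
    ≡⟨ cong₂ ℕ._+_ (trans (List.length-map _ (paths l)) (length-paths l))
                   (trans (List.length-map _ (paths r)) (length-paths r)) ⟩
  ℕ.suc (size l) ℕ.+ ℕ.suc (size r)
    ≡⟨ cong ℕ.suc (ℕ.+-suc (size l) (size r)) ⟩
  ℕ.suc (size (node k l r)) ∎
  where open ≡-Reasoning

splits-bud₁ : ∀ k → splits (bud₁ k) ≡ []
splits-bud₁ low  = refl
splits-bud₁ mid  = refl
splits-bud₁ high = refl

splits-bud₂ : ∀ k → splits (bud₂ k) ≡ []
splits-bud₂ low  = refl
splits-bud₂ mid  = refl
splits-bud₂ high = refl

splits-bud₃ : ∀ k → splits (bud₃ k) ≡ []
splits-bud₃ low  = refl
splits-bud₃ mid  = refl
splits-bud₃ high = refl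

cutᵖ : Path → Word × Word
cutᵖ fs = befores fs , afters fs

splits-++ˡ : ∀ {b} → splits b ≡ [] → ∀ w → splits (b ++ w) ≡ map (map₁ (b ++_)) (splits w)
splits-++ˡ {b} b≡[] w = trans (splits-++ b w)
  (cong (λ s → map (map₂ (_++ w)) s ++ map (map₁ (b ++_)) (splits w)) b≡[])

splits-++ʳ : ∀ {b} → splits b ≡ [] → ∀ w → splits (w ++ b) ≡ map (map₂ (_++ b)) (splits w)
splits-++ʳ {b} b≡[] w =
  trans (splits-++ w b)
  (trans (cong (λ s → map (map₂ (_++ b)) (splits w) ++ map (map₁ (w ++_)) s) b≡[])
         (List.++-identityʳ _))

-- Buds contribute no up step, so the up steps of the word are the non-root leaves, met from left to
-- right on both sides. This turns the counting of leaves into a question about words.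
map-cut-paths : ∀ T → map cutᵖ (paths T) ≡ splits (word T)
map-cut-paths leaf         = refl
map-cut-paths (node k l r) = begin
  map cutᵖ (map (subtreeʳ k r ∷_) (paths l) ++ map (subtreeˡ k l ∷_) (paths r))
    ≡⟨ List.map-++ cutᵖ (map (subtreeʳ k r ∷_) (paths l)) _ ⟩
  map cutᵖ (map (subtreeʳ k r ∷_) (paths l)) ++ map cutᵖ (map (subtreeˡ k l ∷_) (paths r))
    ≡⟨ cong₂ _++_ left right ⟩
  map (map₁ (b₁ ++_)) (map (map₂ (_++ rest)) (splits (word l))) ++
  map (map₁ (b₁ ++_)) (map (map₁ (word l ++_)) (splits rest))
    ≡⟨ List.map-++ _ (map (map₂ (_++ rest)) (splits (word l))) _ ⟨
  map (map₁ (b₁ ++_)) (map (map₂ (_++ rest)) (splits (word l)) ++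
                       map (map₁ (word l ++_)) (splits rest))
    ≡⟨ cong (map _) (splits-++ (word l) rest) ⟨
  map (map₁ (b₁ ++_)) (splits (word l ++ rest))
    ≡⟨ splits-++ˡ (splits-bud₁ k) (word l ++ rest) ⟨
  splits (word (node k l r)) ∎
  where
  open ≡-Reasoning
  b₁ b₂ b₃ rest : Word
  b₁ = bud₁ k
  b₂ = bud₂ k
  b₃ = bud₃ k
  rest = b₂ ++ word r ++ b₃

  left : map cutᵖ (map (subtreeʳ k r ∷_) (paths l)) ≡
         map (map₁ (b₁ ++_)) (map (map₂ (_++ rest)) (splits (word l)))
  left = begin
    map cutᵖ (map (subtreeʳ k r ∷_) (paths l))                        ≡⟨ List.map-∘ (paths l) ⟨
    map (map₁ (b₁ ++_) ∘ map₂ (_++ rest) ∘ cutᵖ) (paths l)            ≡⟨ List.map-∘ (paths l) ⟩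
    map (map₁ (b₁ ++_) ∘ map₂ (_++ rest)) (map cutᵖ (paths l))        ≡⟨ cong (map _) (map-cut-paths l) ⟩
    map (map₁ (b₁ ++_) ∘ map₂ (_++ rest)) (splits (word l))           ≡⟨ List.map-∘ (splits (word l)) ⟩
    map (map₁ (b₁ ++_)) (map (map₂ (_++ rest)) (splits (word l)))     ∎

  regroup : ∀ v → (b₁ ++ word l ++ b₂) ++ v ≡ b₁ ++ word l ++ b₂ ++ v
  regroup v = trans (List.++-assoc b₁ _ v) (cong (b₁ ++_) (List.++-assoc (word l) b₂ v))

  right : map cutᵖ (map (subtreeˡ k l ∷_) (paths r)) ≡
          map (map₁ (b₁ ++_)) (map (map₁ (word l ++_)) (splits rest))
  right = begin
    map cutᵖ (map (subtreeˡ k l ∷_) (paths r))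
      ≡⟨ List.map-∘ (paths r) ⟨
    map (map₁ ((b₁ ++ word l ++ b₂) ++_) ∘ map₂ (_++ b₃) ∘ cutᵖ) (paths r)
      ≡⟨ List.map-∘ (paths r) ⟩
    map (map₁ ((b₁ ++ word l ++ b₂) ++_) ∘ map₂ (_++ b₃)) (map cutᵖ (paths r))
      ≡⟨ cong (map _) (map-cut-paths r) ⟩
    map (map₁ ((b₁ ++ word l ++ b₂) ++_) ∘ map₂ (_++ b₃)) (splits (word r))
      ≡⟨ List.map-cong (λ (v , v′) → cong (_, v′ ++ b₃) (regroup v)) (splits (word r)) ⟩
    map (map₁ (b₁ ++_) ∘ map₁ (word l ++_) ∘ map₁ (b₂ ++_) ∘ map₂ (_++ b₃)) (splits (word r))
      ≡⟨ trans (List.map-∘ (splits (word r))) (trans (List.map-∘ _) (List.map-∘ _)) ⟩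
    map (map₁ (b₁ ++_)) (map (map₁ (word l ++_)) (map (map₁ (b₂ ++_))
      (map (map₂ (_++ b₃)) (splits (word r)))))
      ≡⟨ cong (map (map₁ (b₁ ++_)) ∘ map (map₁ (word l ++_)) ∘ map (map₁ (b₂ ++_)))
              (splits-++ʳ (splits-bud₃ k) (word r)) ⟨
    map (map₁ (b₁ ++_)) (map (map₁ (word l ++_)) (map (map₁ (b₂ ++_)) (splits (word r ++ b₃))))
      ≡⟨ cong (map (map₁ (b₁ ++_)) ∘ map (map₁ (word l ++_))) (splits-++ˡ (splits-bud₂ k) (word r ++ b₃)) ⟨
    map (map₁ (b₁ ++_)) (map (map₁ (word l ++_)) (splits rest)) ∎

-- By `map-cut-paths` the cut of a path is among the splits of the word of its tree, and every split
-- rejoins to that word.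
word-plug : ∀ fs → word (plug fs) ≡ befores fs ++ up ∷ afters fs
word-plug fs = All.lookup (splits-rejoin (word (plug fs)))
  (subst (cutᵖ fs ∈_) (map-cut-paths (plug fs)) (∈-map⁺ cutᵖ (∈-paths fs)))

-- At an inner vertex the two subtrees gain one each and the bud loses one, wherever it stands.
rise-word : ∀ h T → rise h (word T) ≡ 1ℤ + h
rise-word h leaf         = refl
rise-word h (node k l r) = begin
  rise h (word (node k l r))
    ≡⟨ trans (rise-++ h (bud₁ k) _) (trans (rise-++ _ (word l) _)
         (trans (rise-++ _ (bud₂ k) _) (rise-++ _ (word r) _))) ⟩
  rise (rise (rise (rise (rise h (bud₁ k)) (word l)) (bud₂ k)) (word r)) (bud₃ k)
    ≡⟨ cong (λ x → rise x (bud₃ k)) (rise-word _ r) ⟩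
  rise (1ℤ + rise (rise (rise h (bud₁ k)) (word l)) (bud₂ k)) (bud₃ k)
    ≡⟨ cong (λ x → rise (1ℤ + rise x (bud₂ k)) (bud₃ k)) (rise-word _ l) ⟩
  rise (1ℤ + rise (1ℤ + rise h (bud₁ k)) (bud₂ k)) (bud₃ k)
    ≡⟨ buds k h ⟩
  1ℤ + h ∎
  where
  open ≡-Reasoning
  buds : ∀ k h → rise (1ℤ + rise (1ℤ + rise h (bud₁ k)) (bud₂ k)) (bud₃ k) ≡ 1ℤ + h
  buds low  h = cong ℤ.suc (ℤ.suc-pred h)
  buds mid  h = ℤ.suc-pred (1ℤ + h)
  buds high h = ℤ.pred-suc (1ℤ + h)

-- Rerooting

-- A blossom tree with a marked leaf, which may be the root leaf.
data Marked : Set where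
  atRoot : Blossom → Marked
  along  : Path → Marked

tree : Marked → Blossom
tree (atRoot T) = T
tree (along fs) = plug fs

reroot : Marked → Marked
reroot (atRoot T) = atRoot T
reroot (along fs) = along (backwards fs)

reroot-involutive : ∀ z → reroot (reroot z) ≡ z
reroot-involutive (atRoot T) = refl
reroot-involutive (along fs) = cong along (backwards-involutive fs)

reroot-injective : ∀ {y z} → reroot y ≡ reroot z → y ≡ z
reroot-injective {y} {z} eq =
  trans (sym (reroot-involutive y)) (trans (cong reroot eq) (reroot-involutive z))

size-tree-reroot : ∀ z → size (tree (reroot z)) ≡ size (tree z)
size-tree-reroot (atRoot T) = refl
size-tree-reroot (along fs) = size-plug-backwards fs

-- The contour, closed by an up step for the root leaf, around the marked leaf.
cut : Marked → Word × Word
cut (atRoot T) = word T , []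
cut (along fs) = befores fs , afters fs ++ [ up ]

word-tree : ∀ z → word (tree z) ++ [ up ] ≡ proj₁ (cut z) ++ up ∷ proj₂ (cut z)
word-tree (atRoot T) = refl
word-tree (along fs) =
  trans (cong (_++ [ up ]) (word-plug fs)) (List.++-assoc (befores fs) _ _)

-- For a mark other than the root leaf, the new contour starts just after the marked leaf, passes
-- the old root leaf, whose up step ends `proj₂ (cut z)`, and stops just before the marked leaf.
word-reroot : ∀ z → word (tree (reroot z)) ≡ proj₂ (cut z) ++ proj₁ (cut z)
word-reroot (atRoot T) = refl
word-reroot (along fs) = begin
  word (plug (backwards fs))                             ≡⟨ word-plug (backwards fs) ⟩
  befores (backwards fs) ++ up ∷ afters (backwards fs)
    ≡⟨ cong₂ (λ v w → v ++ up ∷ w) (befores-backwards fs) (afters-backwards fs) ⟩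
  afters fs ++ up ∷ befores fs                           ≡⟨ List.++-assoc (afters fs) _ _ ⟨
  (afters fs ++ [ up ]) ++ befores fs                    ∎
  where open ≡-Reasoning

marks : Blossom → List Marked
marks T = map along (paths T) ++ [ atRoot T ]

tree-marks : ∀ T → All (λ z → tree z ≡ T) (marks T)
tree-marks T = All.++⁺ (All.map⁺ (plug-paths T)) (refl ∷ [])

∈-marks : ∀ z → z ∈ marks (tree z)
∈-marks (atRoot T) = ∈-++⁺ʳ (map along (paths T)) (here refl)
∈-marks (along fs) = ∈-++⁺ˡ (∈-map⁺ along (∈-paths fs))

marks-unique : ∀ T → Unique (marks T)
marks-unique T = Unique.++⁺ (Unique.map⁺ (λ { refl → refl }) (paths-unique T)) ([] ∷ []) disjoint
  where
  disjoint : Disjoint (map along (paths T)) [ atRoot T ]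
  disjoint (p , here refl) with _ , _ , () ← ∈-map⁻ along p

length-marks : ∀ T → length (marks T) ≡ 2 ℕ.+ size T
length-marks T = begin
  length (map along (paths T) ++ [ atRoot T ])   ≡⟨ List.length-++ (map along (paths T)) ⟩
  length (map along (paths T)) ℕ.+ 1             ≡⟨ ℕ.+-comm _ 1 ⟩
  ℕ.suc (length (map along (paths T)))           ≡⟨ cong ℕ.suc (List.length-map along (paths T)) ⟩
  ℕ.suc (length (paths T))                       ≡⟨ cong ℕ.suc (length-paths T) ⟩
  2 ℕ.+ size T                                   ∎
  where open ≡-Reasoning

-- The root leaf comes last in `marks` because its up step closes the contour.
map-cut-marks : ∀ T → map cut (marks T) ≡ splits (word T ++ [ up ])
map-cut-marks T = begin
  map cut (map along (paths T) ++ [ atRoot T ])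
    ≡⟨ List.map-++ cut (map along (paths T)) _ ⟩
  map cut (map along (paths T)) ++ [ word T , [] ]
    ≡⟨ cong (_++ [ word T , [] ]) (trans (sym (List.map-∘ (paths T))) (List.map-∘ (paths T))) ⟩
  map (map₂ (_++ [ up ])) (map cutᵖ (paths T)) ++ [ word T , [] ]
    ≡⟨ cong₂ (λ s v → map (map₂ (_++ [ up ])) s ++ [ v , [] ])
             (map-cut-paths T) (sym (List.++-identityʳ (word T))) ⟩
  map (map₂ (_++ [ up ])) (splits (word T)) ++ [ word T ++ [] , [] ]
    ≡⟨ splits-++ (word T) [ up ] ⟨
  splits (word T ++ [ up ]) ∎
  where open ≡-Reasoning

-- Embedded trees

-- The children of a vertex of label i.  The first child has label i - 1, i or
-- i + 1 according to the kind; in the last case the roles of the two subtrees are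
-- exchanged, so that the walk always enters a subtree at the height which is the
-- label of the vertex whose children it encodes.
forest : ℤ → Blossom → List Tree
forest i leaf            = []
forest i (node low  l r) = node (-1ℤ + i) (forest (-1ℤ + i) l) ∷ forest i r
forest i (node mid  l r) = node i (forest i l) ∷ forest i r
forest i (node high l r) = node (1ℤ + i) (forest (1ℤ + i) r) ∷ forest i l

edges-forest : ∀ i T → edgesᶠ (forest i T) ≡ size T
edges-forest i leaf            = refl
edges-forest i (node low  l r) = cong₂ (λ a b → ℕ.suc (a ℕ.+ b)) (edges-forest (-1ℤ + i) l) (edges-forest i r)
edges-forest i (node mid  l r) = cong₂ (λ a b → ℕ.suc (a ℕ.+ b)) (edges-forest i l) (edges-forest i r)
edges-forest i (node high l r) = cong ℕ.suc
  (trans (cong₂ ℕ._+_ (edges-forest (1ℤ + i) r) (edges-forest i l)) (ℕ.+-comm (size r) (size l)))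

ups-low : ∀ i l r → ups i (word (node low l r)) ≡ ups (-1ℤ + i) (word l) ++ ups i (word r)
ups-low i l r = trans (ups-++ (-1ℤ + i) (word l) (word r ++ []))
  (cong₂ (λ h w → ups (-1ℤ + i) (word l) ++ ups h w)
         (trans (rise-word (-1ℤ + i) l) (ℤ.suc-pred i)) (List.++-identityʳ (word r)))

ups-mid : ∀ i l r → ups i (word (node mid l r)) ≡ ups i (word l) ++ ups i (word r)
ups-mid i l r = trans (ups-++ i (word l) (down ∷ word r ++ []))
  (cong₂ (λ h w → ups i (word l) ++ ups h w)
         (trans (cong ℤ.pred (rise-word i l)) (ℤ.pred-suc i)) (List.++-identityʳ (word r)))

ups-high : ∀ i l r → ups i (word (node high l r)) ≡ ups i (word l) ++ ups (1ℤ + i) (word r)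
ups-high i l r = trans (ups-++ i (word l) (word r ++ down ∷ []))
  (cong (ups i (word l) ++_)
    (trans (ups-++ (rise i (word l)) (word r) (down ∷ []))
    (trans (List.++-identityʳ _) (cong (λ h → ups h (word r)) (rise-word i l)))))

-- The parent label `i` is moved past the tree of the first child to head the remaining forest, so
-- that each subtree accounts for one list of the same shape. The orders differ, as preorder lists a
-- parent first and `high` exchanges the subtrees.
labels-forest : ∀ i T → i ∷ labelsᶠ (forest i T) ↭ ups i (word T)
labels-forest i leaf            = ↭-refl
labels-forest i (node low l r)  = ↭-trans
  (↭-sym (Perm.shift i (labels (node (-1ℤ + i) (forest (-1ℤ + i) l))) _))
  (↭-trans (Perm.++⁺ (labels-forest (-1ℤ + i) l) (labels-forest i r))
           (↭-reflexive (sym (ups-low i l r))))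
labels-forest i (node mid l r)  = ↭-trans
  (↭-sym (Perm.shift i (labels (node i (forest i l))) _))
  (↭-trans (Perm.++⁺ (labels-forest i l) (labels-forest i r))
           (↭-reflexive (sym (ups-mid i l r))))
labels-forest i (node high l r) = ↭-trans
  (↭-sym (Perm.shift i (labels (node (1ℤ + i) (forest (1ℤ + i) r))) _))
  (↭-trans (Perm.++⁺ (labels-forest (1ℤ + i) r) (labels-forest i l))
  (↭-trans (Perm.++-comm (ups (1ℤ + i) (word r)) _)
           (↭-reflexive (sym (ups-high i l r)))))

i-pred[i]≡1 : ∀ i → i - (-1ℤ + i) ≡ 1ℤ
i-pred[i]≡1 = solve-∀

i-suc[i]≡-1 : ∀ i → i - (1ℤ + i) ≡ -1ℤ
i-suc[i]≡-1 = solve-∀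

i-[i-j]≡j : ∀ i j → i - (i - j) ≡ j
i-[i-j]≡j = solve-∀

close-forest : ∀ i T → All (λ t → ∣ i - rootLabel t ∣ ≤ 1) (forest i T)
close-forest i leaf            = []
close-forest i (node low  l r) = ℕ.≤-reflexive (cong ∣_∣ (i-pred[i]≡1 i)) ∷ close-forest i r
close-forest i (node mid  l r) =
  subst (λ d → ∣ d ∣ ≤ 1) (sym (ℤ.+-inverseʳ i)) ℕ.z≤n ∷ close-forest i r
close-forest i (node high l r) = ℕ.≤-reflexive (cong ∣_∣ (i-suc[i]≡-1 i)) ∷ close-forest i l

adjacent-forest : ∀ i T → All AdjacentDifferByAtMost1 (forest i T)
adjacent-forest i leaf            = []
adjacent-forest i (node low  l r) =
  node (close-forest (-1ℤ + i) l) (adjacent-forest (-1ℤ + i) l) ∷ adjacent-forest i r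
adjacent-forest i (node mid  l r) =
  node (close-forest i l) (adjacent-forest i l) ∷ adjacent-forest i r
adjacent-forest i (node high l r) =
  node (close-forest (1ℤ + i) r) (adjacent-forest (1ℤ + i) r) ∷ adjacent-forest i l

close-cases : ∀ i j → ∣ i - j ∣ ≤ 1 → j ≡ -1ℤ + i ⊎ j ≡ i ⊎ j ≡ 1ℤ + i
-- Abstracting `i - j` also in the identity that recovers `j` lets each of the differences 0, 1 and
-- -1 determine `j`.
close-cases i j close with i - j | i-[i-j]≡j i j
... | + 0                | eq = inj₂ (inj₁ (trans (sym eq) (ℤ.+-identityʳ i)))
... | + 1                | eq = inj₁ (trans (sym eq) (ℤ.+-comm i -1ℤ))
... | ℤ.-[1+ 0 ]         | eq = inj₂ (inj₂ (trans (sym eq) (ℤ.+-comm i 1ℤ)))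
... | + (ℕ.suc (ℕ.suc _)) | _ = contradiction close λ { (ℕ.s≤s ()) }
... | ℤ.-[1+ ℕ.suc _ ]   | _  = contradiction close λ { (ℕ.s≤s ()) }

forest-surjective : ∀ i ts → All (λ t → ∣ i - rootLabel t ∣ ≤ 1) ts →
                    All AdjacentDifferByAtMost1 ts → Σ[ T ∈ Blossom ] forest i T ≡ ts
forest-surjective i []               []       []                = leaf , refl
forest-surjective i (node j ss ∷ ts) (c ∷ cs) (node ds bs ∷ as)
  with close-cases i j c | forest-surjective j ss ds bs | forest-surjective i ts cs as
... | inj₁ refl        | S , refl | T , refl = node low  S T , refl
... | inj₂ (inj₁ refl) | S , refl | T , refl = node mid  S T , refl
-- In this kind the children of the first tree are encoded by the right subtree.
... | inj₂ (inj₂ refl) | S , refl | T , refl = node high T S , refl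

pred[i]≢i : ∀ {i} → -1ℤ + i ≢ i
pred[i]≢i {i} eq = ℤ.i≢suc[i] (trans eq (sym (ℤ.suc-pred i)))

pred[i]≢suc[i] : ∀ {i} → -1ℤ + i ≢ 1ℤ + i
pred[i]≢suc[i] {i} eq
  with () ← trans (sym (i-pred[i]≡1 i)) (trans (cong (i -_) eq) (i-suc[i]≡-1 i))

children : Tree → List Tree
children (node _ ts) = ts

∷-injective-tree : ∀ {s t ss ts} → s List.∷ ss ≡ t ∷ ts →
                   rootLabel s ≡ rootLabel t × children s ≡ children t × ss ≡ ts
∷-injective-tree refl = refl , refl , refl

-- The label of the first child, compared with `i`, reveals the kind; the two remaining forests then
-- determine the subtrees.
forest-injective : ∀ i S T → forest i S ≡ forest i T → S ≡ T
forest-injective i leaf            leaf            eq = refl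
forest-injective i leaf            (node low  s t) ()
forest-injective i leaf            (node mid  s t) ()
forest-injective i leaf            (node high s t) ()
forest-injective i (node low  l r) leaf            ()
forest-injective i (node mid  l r) leaf            ()
forest-injective i (node high l r) leaf            ()
forest-injective i (node low  l r) (node low  s t) eq with _ , p , q ← ∷-injective-tree eq =
  cong₂ (node low) (forest-injective (-1ℤ + i) l s p) (forest-injective i r t q)
forest-injective i (node mid  l r) (node mid  s t) eq with _ , p , q ← ∷-injective-tree eq =
  cong₂ (node mid) (forest-injective i l s p) (forest-injective i r t q)
forest-injective i (node high l r) (node high s t) eq with _ , p , q ← ∷-injective-tree eq =
  cong₂ (node high) (forest-injective i l s q) (forest-injective (1ℤ + i) r t p)
forest-injective i (node low  l r) (node mid  s t) eq =
  contradiction (proj₁ (∷-injective-tree eq)) pred[i]≢i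
forest-injective i (node low  l r) (node high s t) eq =
  contradiction (proj₁ (∷-injective-tree eq)) (pred[i]≢suc[i] {i})
forest-injective i (node mid  l r) (node low  s t) eq =
  contradiction (sym (proj₁ (∷-injective-tree eq))) pred[i]≢i
forest-injective i (node mid  l r) (node high s t) eq =
  contradiction (proj₁ (∷-injective-tree eq)) ℤ.i≢suc[i]
forest-injective i (node high l r) (node low  s t) eq =
  contradiction (sym (proj₁ (∷-injective-tree eq))) (pred[i]≢suc[i] {i})
forest-injective i (node high l r) (node mid  s t) eq =
  contradiction (sym (proj₁ (∷-injective-tree eq))) ℤ.i≢suc[i]

embed : Blossom → Tree
embed T = node 1ℤ (forest 1ℤ T)

embed-injective : ∀ {S T} → embed S ≡ embed T → S ≡ T
embed-injective {S} {T} eq = forest-injective 1ℤ S T (cong children eq)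

labels-embed : ∀ T → labels (embed T) ↭ ups 1ℤ (word T)
labels-embed = labels-forest 1ℤ

Positive : Word → Set
Positive w = All (0ℤ ℤ.<_) (ups 1ℤ w)

positive? : Decidable Positive
positive? w = All.all? (0ℤ ℤ.<?_) (ups 1ℤ w)

module _ {n : ℕ} where

  embedded : (T : Blossom) → size T ≡ n → 𝒰 n
  embedded T size≡n = record
    { tree     = embed T
    ; edges≡n  = trans (edges-forest 1ℤ T) size≡n
    ; root≡1   = refl
    ; adjacent = node (close-forest 1ℤ T) (adjacent-forest 1ℤ T)
    }

  wellLabelled : (T : Blossom) → size T ≡ n → Positive (word T) → 𝒲 n
  wellLabelled T size≡n pos = record
    { embedded = embedded T size≡n
    ; positive = Perm.All-resp-↭ (↭-sym (labels-embed T)) pos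
    }

  embed-surjective : (u : 𝒰 n) → Σ[ T ∈ Blossom ] embed T ≡ 𝒰.tree u × size T ≡ n
  embed-surjective (mk𝒰 (node _ ts) edges≡n refl (node cs as))
    with T , refl ← forest-surjective 1ℤ ts cs as =
    T , refl , trans (sym (edges-forest 1ℤ T)) edges≡n

  wellLabelled-surjective : (w : 𝒲 n) → Σ[ T ∈ Blossom ]
    embed T ≡ 𝒰.tree (𝒲.embedded w) × size T ≡ n × Positive (word T)
  wellLabelled-surjective (mk𝒲 u pos) with T , eq , size≡n ← embed-surjective u =
    T , eq , size≡n ,
    Perm.All-resp-↭ (↭-trans (↭-reflexive (cong labels (sym eq))) (labels-embed T)) pos

-- The cycle lemma

least : Blossom → ℤ
least T = minLabel (embed T)

least≤1 : ∀ T → least T ℤ.≤ 1ℤ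
least≤1 T = min≤⊤ 1ℤ (labels (embed T))

least≤labels : ∀ T → All (least T ℤ.≤_) (labels (embed T))
least≤labels T = min≤xs 1ℤ (labels (embed T))

least∈labels : ∀ T → least T ∈ labels (embed T)
least∈labels T with argmin-sel id 1ℤ (labels (embed T))
... | inj₁ least≡1 = here least≡1
... | inj₂ least∈  = least∈

-- Reduces a linear inequality to a ring identity.
≤-by : ∀ k {p q a b} → p ℤ.≤ q → b - a ≡ (q - p) + + k → a ℤ.≤ b
≤-by k {p} {q} p≤q eq = ℤ.0≤i-j⇒j≤i (ℤ.≤-trans (ℤ.i≤j⇒0≤j-i p≤q)
  (ℤ.≤-trans (ℤ.i≤i+j (q - p) (+ k)) (ℤ.≤-reflexive (sym eq))))

-- Here `f` is a contour, of total gain 2, cut at an up step which starts at height `ℓ`. In the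
-- rotated walk `v′ ++ v` the heights on `v′` are lowered by `ℓ` and those on `v` are raised by `e`.
module Rotation {f v v′ : Word} (rejoin : f ≡ v ++ up ∷ v′) (rise≡3 : rise 1ℤ f ≡ + 3) where

  ℓ e : ℤ
  ℓ = rise 1ℤ v
  e = + 2 - ℓ

  ups-f : ups 1ℤ f ≡ ups 1ℤ v ++ ℓ ∷ map (_+ ℓ) (ups 1ℤ v′)
  ups-f = trans (cong (ups 1ℤ) rejoin) (trans (ups-++ 1ℤ v (up ∷ v′))
    (cong (λ us → ups 1ℤ v ++ ℓ ∷ us) (ups-shift 1ℤ ℓ v′)))

  rise-v′ : rise 1ℤ v′ ≡ 1ℤ + e
  rise-v′ = trans (cancel (rise 1ℤ v′) ℓ) (trans (cong (_- ℓ) total) (ℤ.+-assoc 1ℤ (+ 2) (ℤ.- ℓ)))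
    where
    cancel : ∀ r l → r ≡ (r + l) - l
    cancel = solve-∀
    total : rise 1ℤ v′ + ℓ ≡ + 3
    total = trans (sym (rise-shift 1ℤ ℓ v′)) (trans (sym (rise-++ 1ℤ v (up ∷ v′)))
              (trans (cong (rise 1ℤ) (sym rejoin)) rise≡3))

  ups-rotated : ups 1ℤ (v′ ++ v) ≡ ups 1ℤ v′ ++ map (_+ e) (ups 1ℤ v)
  ups-rotated = trans (ups-++ 1ℤ v′ v)
    (cong (ups 1ℤ v′ ++_) (trans (cong (λ h → ups h v) rise-v′) (ups-shift 1ℤ e v)))

  module _ (pos : Positive (v′ ++ v)) where

    positiveᵖ : All (0ℤ ℤ.<_) (ups 1ℤ v′) × All (0ℤ ℤ.<_) (map (_+ e) (ups 1ℤ v))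
    positiveᵖ = All.++⁻ (ups 1ℤ v′) (subst (All (0ℤ ℤ.<_)) ups-rotated pos)

    -- On `v` these values are heights of the rotated walk, at the cut they equal 2, and on `v′`
    -- they exceed the rotated heights by 2.
    0<f+e : All (λ u → 0ℤ ℤ.< u + e) (ups 1ℤ f)
    0<f+e = subst (All (λ u → 0ℤ ℤ.< u + e)) (sym ups-f)
      (All.++⁺ (All.map⁻ (proj₂ positiveᵖ))
        (subst (0ℤ ℤ.<_) (sym (ℓ+e≡2 ℓ)) (ℤ.+<+ (ℕ.s≤s ℕ.z≤n)) ∷
         All.map⁺ (All.map (λ {y} 0<y → subst (0ℤ ℤ.<_) (sym (y+ℓ+e y ℓ))
                                          (ℤ.<-≤-trans 0<y (ℤ.i≤i+j y (+ 2))))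
                           (proj₁ positiveᵖ))))
      where
      ℓ+e≡2 : ∀ l → l + (+ 2 - l) ≡ + 2
      ℓ+e≡2 = solve-∀
      y+ℓ+e : ∀ y l → (y + l) + (+ 2 - l) ≡ y + + 2
      y+ℓ+e = solve-∀

    ℓ≤suc : ∀ {M} → M ∈ ups 1ℤ f → ℓ ℤ.≤ ℤ.suc M
    ℓ≤suc {M} M∈f = ≤-by 0 (ℤ.i<j⇒suc[i]≤j (All.lookup 0<f+e M∈f)) (regroup M ℓ)
      where
      regroup : ∀ M l → 1ℤ + M - l ≡ M + (+ 2 - l) - 1ℤ + + 0
      regroup = solve-∀

    ℓ-last : All (ℓ ℤ.<_) (ups (1ℤ + ℓ) v′)
    ℓ-last = subst (All (ℓ ℤ.<_)) (sym (ups-shift 1ℤ ℓ v′))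
      (All.map⁺ (All.map (λ {y} 0<y → subst (ℤ._< y + ℓ) (ℤ.+-identityˡ ℓ) (ℤ.+-monoˡ-< ℓ 0<y))
                         (proj₁ positiveᵖ)))

  ℓ∈f : ℓ ∈ ups 1ℤ f
  ℓ∈f = subst (ℓ ∈_) (sym ups-f) (∈-++⁺ʳ (ups 1ℤ v) (here refl))

  module _ {M : ℤ} (M≤f : All (M ℤ.≤_) (ups 1ℤ f)) where

    -- A last passage at `ℓ` leaves `v′` positive after lowering by `ℓ`. On `v` the heights are at
    -- least `M`, so raising them by `e` makes them at least `M + 2 - ℓ`, which is at least 1.
    rotated-positive : ℓ ℤ.≤ ℤ.suc M → All (ℓ ℤ.<_) (ups (1ℤ + ℓ) v′) → Positive (v′ ++ v)
    rotated-positive ℓ≤1+M ℓ< = subst (All (0ℤ ℤ.<_)) (sym ups-rotated)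
      (All.++⁺
        (All.map (λ {y} ℓ<y+ℓ → ℤ.suc[i]≤j⇒i<j (≤-by 0 (ℤ.i<j⇒suc[i]≤j ℓ<y+ℓ) (cancel y ℓ)))
                 (All.map⁻ (subst (All (ℓ ℤ.<_)) (ups-shift 1ℤ ℓ v′) ℓ<)))
        (All.map⁺ (All.map
          (λ {x} M≤x → ℤ.suc[i]≤j⇒i<j (≤-by 0 (ℤ.≤-trans ℓ≤1+M (ℤ.suc-mono M≤x)) (regroup x ℓ)))
          (All.++⁻ˡ (ups 1ℤ v) (subst (All (M ℤ.≤_)) ups-f M≤f)))))
      where
      cancel : ∀ y l → y - 1ℤ ≡ y + l - (1ℤ + l) + + 0
      cancel = solve-∀
      regroup : ∀ x l → x + (+ 2 - l) - 1ℤ ≡ 1ℤ + x - l + + 0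
      regroup = solve-∀

    -- Minimality of `M` gives `M ≤ ℓ` and positivity gives `ℓ ≤ 1 + M`, so only two heights are
    -- possible for a good cut.
    good-split : M ∈ ups 1ℤ f →
      DisjointUnion (LastAt M 1ℤ) (LastAt (ℤ.suc M) 1ℤ) (λ (v , v′) → Positive (v′ ++ v)) (v , v′)
    good-split M∈f = record
      { split    = split
      ; inˡ      = λ { (refl , ℓ<) → rotated-positive (ℤ.i≤suc[i] ℓ) ℓ< }
      ; inʳ      = λ { (ℓ≡1+M , ℓ<) → rotated-positive (ℤ.≤-reflexive ℓ≡1+M)
                         (subst (λ c → All (c ℤ.<_) (ups (1ℤ + c) v′)) (sym ℓ≡1+M) ℓ<) }
      ; disjoint = λ (ℓ≡M , _) (ℓ≡1+M , _) → ℤ.i≢suc[i] (trans (sym ℓ≡M) ℓ≡1+M)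
      }
      where
      split : Positive (v′ ++ v) → LastAt M 1ℤ (v , v′) ⊎ LastAt (ℤ.suc M) 1ℤ (v , v′)
      split pos with ℓ ℤ.≟ M
      ... | yes refl = inj₁ (refl , ℓ-last pos)
      ... | no ℓ≢M   = inj₂ (ℓ≡1+M , subst (λ c → All (c ℤ.<_) (ups (1ℤ + c) v′)) ℓ≡1+M (ℓ-last pos))
        where
        ℓ≡1+M : ℓ ≡ ℤ.suc M
        ℓ≡1+M = ℤ.≤-antisym (ℓ≤suc pos M∈f)
          (ℤ.i<j⇒suc[i]≤j (ℤ.≤∧≢⇒< (All.lookup M≤f ℓ∈f) (ℓ≢M ∘ sym)))

contour : Blossom → Word
contour T = word T ++ [ up ]

rise-contour : ∀ T → rise 1ℤ (contour T) ≡ + 3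
rise-contour T = trans (rise-++ 1ℤ (word T) [ up ]) (cong ℤ.suc (rise-word 1ℤ T))

least≤contour : ∀ T → All (least T ℤ.≤_) (ups 1ℤ (contour T))
least≤contour T = subst (All (least T ℤ.≤_)) (sym (ups-++ 1ℤ (word T) [ up ]))
  (All.++⁺ (Perm.All-resp-↭ (labels-embed T) (least≤labels T))
    -- The closing up step starts at height 2, while the root label 1 bounds the minimum.
    (ℤ.≤-trans (least≤1 T)
      (ℤ.≤-trans (ℤ.+≤+ (ℕ.s≤s ℕ.z≤n)) (ℤ.≤-reflexive (sym (rise-word 1ℤ T)))) ∷ []))

least∈contour : ∀ T → least T ∈ ups 1ℤ (contour T)
least∈contour T = subst (least T ∈_) (sym (ups-++ 1ℤ (word T) [ up ]))
  (∈-++⁺ˡ (Perm.∈-resp-↭ (labels-embed T) (least∈labels T)))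

Good : Marked → Set
Good z = Positive (word (tree (reroot z)))

good? : Decidable Good
good? z = positive? (word (tree (reroot z)))

rotated? : Decidable {A = Word × Word} (λ (v , v′) → Positive (v′ ++ v))
rotated? (v , v′) = positive? (v′ ++ v)

#-good-marks : ∀ T → (# good?) (marks T) ≡ 2
#-good-marks T = begin
  (# good?) (marks T)
    ≡⟨ cong length (List.filter-≐ good? (rotated? ∘ cut)
         ((λ {z} → subst Positive (word-reroot z)) , (λ {z} → subst Positive (sym (word-reroot z))))
         (marks T)) ⟩
  (# (rotated? ∘ cut)) (marks T)               ≡⟨ #-map rotated? cut (marks T) ⟨
  (# rotated?) (map cut (marks T))             ≡⟨ cong (# rotated?) (map-cut-marks T) ⟩
  (# rotated?) (splits (contour T))
    ≡⟨ #-⊎ (lastAt? m₀ 1ℤ) (lastAt? (ℤ.suc m₀) 1ℤ) rotated?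
           (All.map (λ eq → Rotation.good-split eq (rise-contour T) (least≤contour T) (least∈contour T))
                    (splits-rejoin (contour T))) ⟩
  (# lastAt? m₀ 1ℤ) (splits (contour T)) ℕ.+ (# lastAt? (ℤ.suc m₀) 1ℤ) (splits (contour T))
    ≡⟨ cong₂ ℕ._+_ (once m₀ (ℤ.i≤suc[i] m₀) ℤ.≤-refl) (once (ℤ.suc m₀) ℤ.≤-refl (ℤ.i≤suc[i] m₀)) ⟩
  2 ∎
  where
  open ≡-Reasoning
  m₀ : ℤ
  m₀ = least T
  -- Both heights are at most 2, below the final height 3, and at least the minimum, which is
  -- attained; hence there is exactly one last passage at each.
  once : ∀ c → c ℤ.≤ ℤ.suc m₀ → m₀ ℤ.≤ c → (# lastAt? c 1ℤ) (splits (contour T)) ≡ 1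
  once c c≤1+m₀ m₀≤c = #-lastAt≡1 c 1ℤ (contour T)
    (subst (c ℤ.<_) (sym (rise-contour T))
      (ℤ.≤-<-trans (ℤ.≤-trans c≤1+m₀ (ℤ.suc-mono (least≤1 T))) (ℤ.+<+ ℕ.≤-refl)))
    (λ c< → ℤ.<-irrefl refl (ℤ.≤-<-trans m₀≤c (All.lookup c< (least∈contour T))))

-- Comparison of the labels

Matching : (ℤ → ℤ → Set) → List ℤ → List ℤ → Set
Matching R xs ys = Σ[ xs′ ∈ List ℤ ] Σ[ ys′ ∈ List ℤ ] xs ↭ xs′ × ys′ ↭ ys × Pointwise R xs′ ys′

matching-resp : ∀ {R xs xs′ ys ys′} → xs′ ↭ xs → ys ↭ ys′ → Matching R xs ys → Matching R xs′ ys′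
matching-resp p q (_ , _ , r , s , pw) = _ , _ , ↭-trans p r , ↭-trans s q , pw

all-matching : ∀ {R xs ys} {P Q : Pred ℤ 0ℓ} → Matching R xs ys →
               (∀ {x y} → R x y → P x → Q y) → All P xs → All Q ys
all-matching {R} {P = P} {Q} (_ , _ , xs↭ , ↭ys , pw) step ps =
  Perm.All-resp-↭ ↭ys (go pw (Perm.All-resp-↭ xs↭ ps))
  where
  go : ∀ {xs ys} → Pointwise R xs ys → All P xs → All Q ys
  go []       []       = []
  go (r ∷ rs) (p ∷ ps) = step r p ∷ go rs ps

#≤_ : ℤ → List ℤ → ℕ
(#≤ c) xs = (# (ℤ._≤? c)) xs

#≤-matching : ∀ {R xs ys} c d → Matching R xs ys →
              (∀ {x y} → R x y → x ℤ.≤ c → y ℤ.≤ d) → (#≤ c) xs ≤ (#≤ d) ys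
#≤-matching {R} {xs} {ys} c d (xs′ , ys′ , xs↭ , ↭ys , pw) step = begin
  (#≤ c) xs   ≡⟨ Perm.↭-length (Perm.filter-↭ (ℤ._≤? c) xs↭) ⟩
  (#≤ c) xs′  ≤⟨ go pw ⟩
  (#≤ d) ys′  ≡⟨ Perm.↭-length (Perm.filter-↭ (ℤ._≤? d) ↭ys) ⟩
  (#≤ d) ys   ∎
  where
  open ℕ.≤-Reasoning
  go : ∀ {xs ys} → Pointwise R xs ys → (#≤ c) xs ≤ (#≤ d) ys
  go []                 = ℕ.z≤n
  go (_∷_ {x} {y} r rs) with x ℤ.≤? c | y ℤ.≤? d
  ... | yes _   | yes _   = ℕ.s≤s (go rs)
  ... | yes x≤c | no y≰d  = contradiction (step r x≤c) y≰d
  ... | no _    | yes _   = ℕ.m≤n⇒m≤1+n (go rs)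
  ... | no _    | no _    = go rs

#≤-none : ∀ {b c} xs → c ℤ.≤ b → All (b ℤ.<_) xs → (#≤ c) xs ≡ 0
#≤-none xs c≤b b< = cong length (List.filter-none (ℤ._≤? _)
  (All.map (λ b<x → ℤ.<⇒≱ (ℤ.≤-<-trans c≤b b<x)) b<))

-- Raising `k` by one adds the entries equal to the new bound. As all entries exceed `b`, none lies
-- below the first summand, and for `k` at most 0 both sides vanish.
∑₁-# : ∀ b xs {f : ℤ → ℕ} → (∀ i → f i ≡ (# (ℤ._≟ b + i)) xs) → All (b ℤ.<_) xs →
       ∀ k → ∑₁ k f ≡ (#≤ (b + k)) xs
∑₁-# b xs f≡ b< ℤ.-[1+ k ]    = sym (#≤-none xs (ℤ.i≤j⇒i-k≤j (+ ℕ.suc k) ℤ.≤-refl) b<)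
∑₁-# b xs f≡ b< (+ ℕ.zero)    = sym (#≤-none xs (ℤ.≤-reflexive (ℤ.+-identityʳ b)) b<)
∑₁-# b xs {f} f≡ b< (+ ℕ.suc k) = begin
  sum (map g (upTo (ℕ.suc k)))                    ≡⟨ cong (sum ∘ map g) (List.upTo-∷ʳ k) ⟨
  sum (map g (upTo k ++ [ k ]))                   ≡⟨ cong sum (List.map-++ g (upTo k) [ k ]) ⟩
  sum (map g (upTo k) ++ [ g k ])                 ≡⟨ sum-++ (map g (upTo k)) [ g k ] ⟩
  ∑₁ (+ k) f ℕ.+ (g k ℕ.+ 0)
    ≡⟨ cong₂ ℕ._+_ (∑₁-# b xs f≡ b< (+ k)) (trans (ℕ.+-identityʳ _) (f≡ _)) ⟩
  (#≤ (b + + k)) xs ℕ.+ (# (ℤ._≟ b + + ℕ.suc k)) xs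
    ≡⟨ #-⊎ (ℤ._≤? b + + k) (ℤ._≟ b + + ℕ.suc k) (ℤ._≤? b + + ℕ.suc k)
           (All.universal step xs) ⟨
  (#≤ (b + + ℕ.suc k)) xs                         ∎
  where
  open ≡-Reasoning
  g : ℕ → ℕ
  g i = f (+ ℕ.suc i)
  b+1+k : b + + ℕ.suc k ≡ ℤ.suc (b + + k)
  b+1+k = trans (sym (ℤ.+-assoc b 1ℤ (+ k)))
            (trans (cong (_+ + k) (ℤ.+-comm b 1ℤ)) (ℤ.+-assoc 1ℤ b (+ k)))
  step : ∀ x → DisjointUnion (ℤ._≤ b + + k) (_≡ b + + ℕ.suc k) (ℤ._≤ b + + ℕ.suc k) x
  step x = record
    { split    = λ x≤ → [ (λ x< → inj₁ (subst (x ℤ.≤_) (trans (cong ℤ.pred b+1+k) (ℤ.pred-suc (b + + k)))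
                                             (ℤ.i<j⇒i≤pred[j] x<)))
                        , inj₂ ]′ (≤⇒<⊎≡ x≤)
    ; inˡ      = λ x≤ → ℤ.≤-trans x≤ (subst (b + + k ℤ.≤_) (sym b+1+k) (ℤ.i≤suc[i] _))
    ; inʳ      = ℤ.≤-reflexive
    ; disjoint = λ { x≤ refl → ℤ.<⇒≱ (ℤ.suc[i]≤j⇒i<j (ℤ.≤-reflexive (sym b+1+k))) x≤ }
    }
    where
    ≤⇒<⊎≡ : ∀ {i j} → i ℤ.≤ j → i ℤ.< j ⊎ i ≡ j
    ≤⇒<⊎≡ {i} {j} i≤j with i ℤ.≟ j
    ... | yes i≡j = inj₂ i≡j
    ... | no  i≢j = inj₁ (ℤ.≤∧≢⇒< i≤j i≢j)

-- Here `x` is a label before rerooting, `y` its partner afterwards and `m` the old minimum.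
-- Renumbered from 1 as in `Λ̂`, `x` becomes `x - m + 1`; then `y` exceeds this by at most 1 and
-- falls short of it by at most 2.
Above Below : ℤ → ℤ → ℤ → Set
Above m x y = y + m ℤ.≤ + 2 + x
Below m y x = x ℤ.≤ 1ℤ + (y + m)

+-monoˡ-≤-suc : ∀ d g {h} → h ℤ.≤ 1ℤ + g → h + d ℤ.≤ 1ℤ + (g + d)
+-monoˡ-≤-suc d g h≤1+g = ℤ.≤-trans (ℤ.+-monoˡ-≤ d h≤1+g) (ℤ.≤-reflexive (ℤ.+-assoc 1ℤ g d))

-- The height `g` is the start of the preceding up step. Only down steps intervene before the next
-- one, which therefore starts at most one higher; the final height serves as the last successor.
climb : ∀ d g h v → h ℤ.≤ 1ℤ + g →
        Pointwise (λ x y → y + d ℤ.≤ 1ℤ + x) (map (_+ d) (g ∷ ups h v)) (ups h v ++ [ rise h v ])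
climb d g h []         h≤1+g = +-monoˡ-≤-suc d g h≤1+g ∷ []
climb d g h (up ∷ v)   h≤1+g = +-monoˡ-≤-suc d g h≤1+g ∷ climb d h (1ℤ + h) v ℤ.≤-refl
climb d g h (down ∷ v) h≤1+g = climb d g (-1ℤ + h) v (ℤ.i≤j⇒pred[i]≤j h≤1+g)

pointwise-mapʳ : ∀ {R : ℤ → ℤ → Set} {f : ℤ → ℤ} → (∀ x → R x (f x)) → ∀ xs → Pointwise R xs (map f xs)
pointwise-mapʳ Rf []       = []
pointwise-mapʳ Rf (x ∷ xs) = Rf x ∷ pointwise-mapʳ Rf xs

pointwise-mapˡ : ∀ {R : ℤ → ℤ → Set} {f : ℤ → ℤ} → (∀ x → R (f x) x) → ∀ xs → Pointwise R (map f xs) xs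
pointwise-mapˡ Rf []       = []
pointwise-mapˡ Rf (x ∷ xs) = Rf x ∷ pointwise-mapˡ Rf xs

Comparable : ℤ → List ℤ → List ℤ → Set
Comparable m us ws = Matching (Above m) us ws × Matching (Below m) ws us

-- Below matches each leaf with itself and the old root with the new one.  For
-- Above, the leaves after the new root are matched with their successors on the
-- walk, which can be at most one step higher.
comparable-swap : ∀ (v v₀ : Word) m →
  let ℓ = rise 1ℤ v ; e = rise 1ℤ v₀ in
  ℓ + e ≡ + 2 → 1ℤ ℤ.≤ e → m ℤ.≤ ℓ → ℓ ℤ.≤ ℤ.suc m →
  Comparable m (ups 1ℤ (v ++ up ∷ v₀)) (ups 1ℤ (v₀ ++ up ∷ v))
comparable-swap v v₀ m ℓ+e≡2 1≤e m≤ℓ ℓ≤1+m =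
  -- The entry `0ℤ`, shifted by `ℓ`, is the marked leaf, and `e` is the height of the old root leaf
  -- on the rerooted walk: `climb` leads from one to the other along `v₀`.
  ( map (_+ ℓ) (0ℤ ∷ Y) ++ X , (Y ++ [ e ]) ++ map (_+ e) X
  , ↭-trans (↭-reflexive ups-v)
      (↭-trans (Perm.++-comm X _)
               (↭-reflexive (cong (λ i → (i ∷ map (_+ ℓ) Y) ++ X) (sym (ℤ.+-identityˡ ℓ)))))
  , ↭-reflexive (trans (List.++-assoc Y [ e ] _) (sym ups-v₀))
  , Pointwise.++⁺
      (Pointwise.map (λ {x} {y} → above-Y {x} {y}) (climb ℓ 0ℤ 1ℤ v₀ ℤ.≤-refl))
      (pointwise-mapʳ above-X X) )
  ,
  ( map (_+ e) X ++ e ∷ Y , X ++ ℓ ∷ map (_+ ℓ) Y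
  , ↭-trans (↭-reflexive ups-v₀)
      (↭-trans (Perm.++-comm Y _) (↭-sym (Perm.shift e (map (_+ e) X) Y)))
  , ↭-reflexive (sym ups-v)
  , Pointwise.++⁺ (pointwise-mapˡ below-X X)
      (below-ℓ ∷ pointwise-mapʳ below-Y Y) )
  where
  ℓ e : ℤ
  ℓ = rise 1ℤ v
  e = rise 1ℤ v₀
  X Y : List ℤ
  X = ups 1ℤ v
  Y = ups 1ℤ v₀

  ups-v : ups 1ℤ (v ++ up ∷ v₀) ≡ X ++ ℓ ∷ map (_+ ℓ) Y
  ups-v = trans (ups-++ 1ℤ v _) (cong (λ us → X ++ ℓ ∷ us) (ups-shift 1ℤ ℓ v₀))

  ups-v₀ : ups 1ℤ (v₀ ++ up ∷ v) ≡ Y ++ e ∷ map (_+ e) X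
  ups-v₀ = trans (ups-++ 1ℤ v₀ _) (cong (λ us → Y ++ e ∷ us) (ups-shift 1ℤ e v))

  above-Y : ∀ {x y} → y + ℓ ℤ.≤ 1ℤ + x → Above m x y
  above-Y {x} {y} y+ℓ≤1+x =
    ≤-by 1 (ℤ.≤-trans (ℤ.+-monoʳ-≤ y m≤ℓ) y+ℓ≤1+x) (regroup x y m)
    where
    regroup : ∀ x y m → + 2 + x - (y + m) ≡ 1ℤ + x - (y + m) + + 1
    regroup = solve-∀

  above-X : ∀ x → x + e + m ℤ.≤ + 2 + x
  above-X x = subst (λ t → x + e + m ℤ.≤ t + x) ℓ+e≡2 (≤-by 0 m≤ℓ (regroup x e m ℓ))
    where
    regroup : ∀ x e m l → l + e + x - (x + e + m) ≡ l - m + + 0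
    regroup = solve-∀

  below-X : ∀ x → x ℤ.≤ 1ℤ + (x + e + m)
  -- The slack 2 is `ℓ + e`.
  below-X x = ≤-by 2 ℓ≤1+m (trans (regroup x e m ℓ) (cong (λ t → 1ℤ + m - ℓ + t) ℓ+e≡2))
    where
    regroup : ∀ x e m l → 1ℤ + (x + e + m) - x ≡ 1ℤ + m - l + (l + e)
    regroup = solve-∀

  below-ℓ : ℓ ℤ.≤ 1ℤ + (e + m)
  below-ℓ = ≤-by 1 (ℤ.+-mono-≤ ℓ≤1+m 1≤e) (regroup e m ℓ)
    where
    regroup : ∀ e m l → 1ℤ + (e + m) - l ≡ 1ℤ + m + e - (l + 1ℤ) + + 1
    regroup = solve-∀

  below-Y : ∀ y → y + ℓ ℤ.≤ 1ℤ + (y + m)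
  below-Y y = ≤-by 0 ℓ≤1+m (regroup y m ℓ)
    where
    regroup : ∀ y m l → 1ℤ + (y + m) - (y + l) ≡ 1ℤ + m - l + + 0
    regroup = solve-∀

-- For the root leaf as mark nothing moves, and pairing each label with itself turns the two
-- relations into bounds on `m`.
comparable-refl : ∀ {m} us → -1ℤ ℤ.≤ m → m ℤ.≤ + 2 → Comparable m us us
comparable-refl {m} us -1≤m m≤2 =
  (us , us , ↭-refl , ↭-refl , Pointwise.refl (λ {x} → above x)) ,
  (us , us , ↭-refl , ↭-refl , Pointwise.refl (λ {x} → below x))
  where
  above : ∀ x → x + m ℤ.≤ + 2 + x
  above x = ≤-by 0 m≤2 (regroup x m)
    where
    regroup : ∀ x m → + 2 + x - (x + m) ≡ + 2 - m + + 0
    regroup = solve-∀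
  below : ∀ x → x ℤ.≤ 1ℤ + (x + m)
  below x = ≤-by 0 -1≤m (regroup x m)
    where
    regroup : ∀ x m → 1ℤ + (x + m) - x ≡ m - -1ℤ + + 0
    regroup = solve-∀

comparable-reroot : ∀ z → Good z →
  Comparable (least (tree z)) (ups 1ℤ (word (tree z))) (ups 1ℤ (word (tree (reroot z))))
comparable-reroot (atRoot T) good = comparable-refl (ups 1ℤ (word T))
  (ℤ.≤-trans ℤ.-≤+ (ℤ.<⇒≤ 0<least)) (ℤ.≤-trans (least≤1 T) (ℤ.i≤suc[i] 1ℤ))
  where
  0<least : 0ℤ ℤ.< least T
  0<least = All.lookup good (Perm.∈-resp-↭ (labels-embed T) (least∈labels T))
comparable-reroot z@(along fs) good =
  subst₂ (λ v w → Comparable m₀ (ups 1ℤ v) (ups 1ℤ w)) (sym (word-plug fs)) (sym word-back)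
    (comparable-swap v v₀ m₀ ℓ+e≡2 1≤e
      (All.lookup (least≤contour T) R.ℓ∈f)
      (R.ℓ≤suc (subst Positive (word-reroot z) good) (least∈contour T)))
  where
  T : Blossom
  T = plug fs
  m₀ : ℤ
  m₀ = least T
  v v₀ : Word
  v  = befores fs
  v₀ = afters fs

  module R = Rotation (word-tree z) (rise-contour T)

  word-back : word (plug (backwards fs)) ≡ v₀ ++ up ∷ v
  word-back = trans (word-reroot z) (List.++-assoc v₀ [ up ] v)

  ℓ+e≡2 : rise 1ℤ v + rise 1ℤ v₀ ≡ + 2
  ℓ+e≡2 = begin
    rise 1ℤ v + rise 1ℤ v₀    ≡⟨ ℤ.+-comm (rise 1ℤ v) _ ⟩
    rise 1ℤ v₀ + rise 1ℤ v    ≡⟨ rise-shift 1ℤ (rise 1ℤ v) v₀ ⟨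
    rise (rise 1ℤ v) (up ∷ v₀) ≡⟨ rise-++ 1ℤ v (up ∷ v₀) ⟨
    rise 1ℤ (v ++ up ∷ v₀)    ≡⟨ cong (rise 1ℤ) (word-plug fs) ⟨
    rise 1ℤ (word T)          ≡⟨ rise-word 1ℤ T ⟩
    + 2                       ∎
    where open ≡-Reasoning

  1≤e : 1ℤ ℤ.≤ rise 1ℤ v₀
  -- The height of the old root leaf on the rerooted walk is `e`, and the heights of the leaves
  -- there are positive.
  1≤e = ℤ.i<j⇒suc[i]≤j (All.lookup good
    (subst (rise 1ℤ v₀ ∈_) (sym (trans (cong (ups 1ℤ) word-back) (ups-++ 1ℤ v₀ (up ∷ v))))
           (∈-++⁺ʳ (ups 1ℤ v₀) (here refl))))

-- Label counts and label ranges of the two trees.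

largest : Blossom → ℤ
largest T = maxLabel (embed T)

labels≤largest : ∀ T → All (ℤ._≤ largest T) (labels (embed T))
labels≤largest T = xs≤max 1ℤ (labels (embed T))

largest∈labels : ∀ T → largest T ∈ labels (embed T)
largest∈labels T with argmax-sel id 1ℤ (labels (embed T))
... | inj₁ largest≡1 = here largest≡1
... | inj₂ largest∈  = largest∈

∣d∣≤3 : ∀ d → -1ℤ ℤ.≤ d → d ℤ.≤ + 2 → ∣ d ∣ ≤ 3
∣d∣≤3 (+ _)        _           (ℤ.+≤+ n≤2) = ℕ.m≤n⇒m≤1+n n≤2
∣d∣≤3 ℤ.-[1+ _ ] (ℤ.-≤- n≤0) _           = ℕ.≤-trans (ℕ.s≤s n≤0) (ℕ.s≤s ℕ.z≤n)

Compared : ∀ {n} → 𝒲 n × 𝒰 n → Set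
Compared (w , u) =
  ((k : ℤ) → (Λ̂ u (k - + 2) ≤ λ̂ w k) × (λ̂ w k ≤ Λ̂ u (k + + 2))) ×
  (∣ μ w - (M u - m u) ∣ ≤ 3)

module _ {n : ℕ} (z : Marked) (good : Good z)
         (size-U : size (tree z) ≡ n) (size-W : size (tree (reroot z)) ≡ n) where

  private
    U W : Blossom
    U = tree z
    W = tree (reroot z)
    u : 𝒰 n
    u = embedded U size-U
    w : 𝒲 n
    w = wellLabelled W size-W good
    us ws : List ℤ
    us = labels (embed U)
    ws = labels (embed W)
    b : ℤ
    -- The sum `Λ̂` starts at the minimal label, which is `b + 1`.
    b = least U - 1ℤ

    comparable : Comparable (least U) us ws
    comparable with above , below ← comparable-reroot z good =
      matching-resp (labels-embed U) (↭-sym (labels-embed W)) above ,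
      matching-resp (labels-embed W) (↭-sym (labels-embed U)) below

    Λ̂-#≤ : ∀ k → Λ̂ u k ≡ (#≤ (b + k)) us
    Λ̂-#≤ = ∑₁-# b us (λ i → cong (λ j → (# (ℤ._≟ j)) us) (regroup (least U) i))
             (All.map (λ {x} l≤x → ℤ.suc[i]≤j⇒i<j (≤-by 0 l≤x (regroup′ (least U) x))) (least≤labels U))
      where
      regroup : ∀ l i → l + i - 1ℤ ≡ l - 1ℤ + i
      regroup = solve-∀
      regroup′ : ∀ l x → x - (1ℤ + (l - 1ℤ)) ≡ x - l + + 0
      regroup′ = solve-∀

    λ̂-#≤ : ∀ k → λ̂ w k ≡ (#≤ k) ws
    λ̂-#≤ k = trans
      (∑₁-# 0ℤ ws (λ i → cong (λ j → (# (ℤ._≟ j)) ws) (sym (ℤ.+-identityˡ i))) (𝒲.positive w) k)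
      (cong (λ j → (#≤ j) ws) (ℤ.+-identityˡ k))

    lower : ∀ k → Λ̂ u (k - + 2) ≤ λ̂ w k
    lower k = subst₂ _≤_ (sym (Λ̂-#≤ (k - + 2))) (sym (λ̂-#≤ k))
      -- The labels counted on the left are at most `least U + k - 3`, so their partners are at most
      -- `k - 1`; hence the slack 1.
      (#≤-matching (b + (k - + 2)) k (proj₁ comparable) λ {x} {y} y+m≤2+x x≤ →
        ≤-by 1 (ℤ.≤-trans y+m≤2+x (ℤ.+-monoʳ-≤ (+ 2) x≤)) (regroup (least U) k y))
      where
      regroup : ∀ l k y → k - y ≡ + 2 + (l - 1ℤ + (k - + 2)) - (y + l) + + 1
      regroup = solve-∀

    upper : ∀ k → λ̂ w k ≤ Λ̂ u (k + + 2)
    upper k = subst₂ _≤_ (sym (λ̂-#≤ k)) (sym (Λ̂-#≤ (k + + 2)))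
      -- Labels up to `k` have partners up to `least U + k + 1`, which is `b + (k + 2)`.
      (#≤-matching k (b + (k + + 2)) (proj₂ comparable) λ {y} {x} x≤1+y+m y≤k →
        ≤-by 0 (ℤ.≤-trans x≤1+y+m (ℤ.+-monoʳ-≤ 1ℤ (ℤ.+-monoˡ-≤ (least U) y≤k))) (regroup (least U) k x))
      where
      regroup : ∀ l k x → l - 1ℤ + (k + + 2) - x ≡ 1ℤ + (k + l) - x + + 0
      regroup = solve-∀

    width : ∣ μ w - (M u - m u) ∣ ≤ 3
    -- Each maximum is bounded through the partners of its label: `Below` puts the difference at -1
    -- or more, `Above` at 2 or less.
    width = ∣d∣≤3 (largest W - (largest U - least U))
      (≤-by 0 largestU≤ (regroup₁ (least U) (largest U) (largest W)))
      (≤-by 0 largestW≤ (regroup₂ (least U) (largest U) (largest W)))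
      where
      largestU≤ : largest U ℤ.≤ 1ℤ + (largest W + least U)
      largestU≤ = All.lookup
        (all-matching (proj₂ comparable)
          (λ x≤ y≤ → ℤ.≤-trans x≤ (ℤ.+-monoʳ-≤ 1ℤ (ℤ.+-monoˡ-≤ (least U) y≤)))
          (labels≤largest W))
        (largest∈labels U)
      largestW≤ : largest W + least U ℤ.≤ + 2 + largest U
      largestW≤ = All.lookup {P = λ y → y + least U ℤ.≤ + 2 + largest U}
        (all-matching (proj₁ comparable)
          (λ y≤ x≤ → ℤ.≤-trans y≤ (ℤ.+-monoʳ-≤ (+ 2) x≤))
          (labels≤largest U))
        (largest∈labels W)
      regroup₁ : ∀ l M W → W - (M - l) - -1ℤ ≡ 1ℤ + (W + l) - M + + 0
      regroup₁ = solve-∀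
      regroup₂ : ∀ l M W → + 2 - (W - (M - l)) ≡ + 2 + M - (W + l) + + 0
      regroup₂ = solve-∀

  compared : Compared (w , u)
  compared = (λ k → lower k , upper k) , width

-- Enumeration

-- The argument bounds the height. As the height is at most the size, all trees of size at most `d`
-- occur; `candidates` filters by exact size.
blossoms : ℕ → List Blossom
blossoms ℕ.zero    = [ leaf ]
blossoms (ℕ.suc d) = leaf ∷ cartesianProductWith (λ k (l , r) → node k l r)
  (low ∷ mid ∷ high ∷ []) (cartesianProduct (blossoms d) (blossoms d))

∈-kinds : ∀ k → k ∈ low ∷ mid ∷ high ∷ []
∈-kinds low  = here refl
∈-kinds mid  = there (here refl)
∈-kinds high = there (there (here refl))

∈-blossoms : ∀ d T → size T ≤ d → T ∈ blossoms d
∈-blossoms ℕ.zero    leaf         _              = here refl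
∈-blossoms (ℕ.suc d) leaf         _              = here refl
∈-blossoms (ℕ.suc d) (node k l r) (ℕ.s≤s size≤d) =
  there (∈-cartesianProductWith⁺ (λ k (l , r) → node k l r) (∈-kinds k)
    (∈-cartesianProduct⁺ (∈-blossoms d l (ℕ.m+n≤o⇒m≤o (size l) size≤d))
                         (∈-blossoms d r (ℕ.m+n≤o⇒n≤o (size l) size≤d))))

blossoms-unique : ∀ d → Unique (blossoms d)
blossoms-unique ℕ.zero    = [] ∷ []
blossoms-unique (ℕ.suc d) =
  All.tabulate leaf≢ ∷
  Unique.cartesianProductWith⁺ (λ k (l , r) → node k l r) (λ { refl → refl , refl })
    (((λ ()) ∷ (λ ()) ∷ []) ∷ ((λ ()) ∷ []) ∷ [] ∷ [])
    (Unique.cartesianProduct⁺ (blossoms-unique d) (blossoms-unique d))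
  where
  leaf≢ : ∀ {T} → T ∈ cartesianProductWith (λ k (l , r) → node k l r)
            (low ∷ mid ∷ high ∷ []) (cartesianProduct (blossoms d) (blossoms d)) → leaf ≢ T
  leaf≢ T∈ refl with _ , _ , _ , _ , () ← ∈-cartesianProductWith⁻ (λ k (l , r) → node k l r)
    (low ∷ mid ∷ high ∷ []) (cartesianProduct (blossoms d) (blossoms d)) T∈

concatMap-marks-unique : ∀ {Ts} → Unique Ts → Unique (concatMap marks Ts)
concatMap-marks-unique {[]}     []           = []
concatMap-marks-unique {T ∷ Ts} (T∉Ts ∷ Ts!) =
  Unique.++⁺ (marks-unique T) (concatMap-marks-unique Ts!) disjoint
  where
  disjoint : Disjoint (marks T) (concatMap marks Ts)
  disjoint {z} (p , q) = contradiction refl (All.lookup T∉Ts (Any.map at-tree (∈-concatMap⁻ marks q)))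
    where
    at-tree : ∀ {S} → z ∈ marks S → T ≡ S
    at-tree r = trans (sym (All.lookup (tree-marks T) p)) (All.lookup (tree-marks _) r)

unique∧set⇒↭ : {A : Set} {xs ys : List A} → Unique xs → Unique ys →
               (∀ {z} → z ∈ xs → z ∈ ys) → (∀ {z} → z ∈ ys → z ∈ xs) → xs ↭ ys
unique∧set⇒↭ xs! ys! to from = ∼bag⇒↭ (unique∧set⇒bag xs! ys! (mk⇔ to from))

-- The sample space and its fibres over the trees.

Admissible : ℕ → Marked → Set
Admissible n z = size (tree z) ≡ n × Good z

admissible? : ∀ n → Decidable (Admissible n)
admissible? n z = size (tree z) ℕ.≟ n ×-dec good? z

candidates : ℕ → List Marked
candidates n = filter (admissible? n) (concatMap marks (blossoms n))

candidates-unique : ∀ n → Unique (candidates n)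
candidates-unique n = Unique.filter⁺ (admissible? n) (concatMap-marks-unique (blossoms-unique n))

∈-candidates⁺ : ∀ {n z} → Admissible n z → z ∈ candidates n
∈-candidates⁺ {n} {z} adm@(size≡n , _) = ∈-filter⁺ (admissible? n)
  (∈-concatMap⁺ marks (Any.map (λ { refl → ∈-marks z })
    (∈-blossoms n (tree z) (ℕ.≤-reflexive size≡n)))) adm

∈-candidates⁻ : ∀ {n z} → z ∈ candidates n → Admissible n z
∈-candidates⁻ {n} z∈ = proj₂ (∈-filter⁻ (admissible? n) {xs = concatMap marks (blossoms n)} z∈)

treeᵁ? : ∀ t → Decidable (λ z → embed (tree z) ≡ t)
treeᵁ? t z = embed (tree z) ≟ᵗ t

treeᵂ? : ∀ t → Decidable (λ z → embed (tree (reroot z)) ≡ t)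
treeᵂ? t z = embed (tree (reroot z)) ≟ᵗ t

∈-marks-of : ∀ {z T} → tree z ≡ T → z ∈ marks T
∈-marks-of {z} refl = ∈-marks z

-- Since `embed` is injective, the fibre consists of the good marks of `T`, which the cycle lemma
-- counts.
#-treeᵁ : ∀ n T → size T ≡ n → (# treeᵁ? (embed T)) (candidates n) ≡ 2
#-treeᵁ n T size≡n = trans (Perm.↭-length same) (#-good-marks T)
  where
  to : ∀ {z} → z ∈ filter (treeᵁ? (embed T)) (candidates n) → z ∈ filter good? (marks T)
  to {z} z∈ with z∈c , eq ← ∈-filter⁻ (treeᵁ? (embed T)) {xs = candidates n} z∈ =
    ∈-filter⁺ good? (∈-marks-of (embed-injective eq)) (proj₂ (∈-candidates⁻ {n} z∈c))

  from : ∀ {z} → z ∈ filter good? (marks T) → z ∈ filter (treeᵁ? (embed T)) (candidates n)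
  from {z} z∈ with z∈m , good ← ∈-filter⁻ good? {xs = marks T} z∈
              with tree≡T ← All.lookup (tree-marks T) z∈m =
    ∈-filter⁺ (treeᵁ? (embed T)) (∈-candidates⁺ (trans (cong size tree≡T) size≡n , good))
              (cong embed tree≡T)

  same : filter (treeᵁ? (embed T)) (candidates n) ↭ filter good? (marks T)
  same = unique∧set⇒↭ (Unique.filter⁺ (treeᵁ? (embed T)) (candidates-unique n))
                      (Unique.filter⁺ good? (marks-unique T)) to from

-- As `reroot` is an involution, the fibre is the image of all marks of `T`: rerooting such an image
-- gives back `T`, whose positivity makes it good.
#-treeᵂ : ∀ n T → size T ≡ n → Positive (word T) → (# treeᵂ? (embed T)) (candidates n) ≡ 2 ℕ.+ n
#-treeᵂ n T size≡n pos = begin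
  (# treeᵂ? (embed T)) (candidates n)   ≡⟨ Perm.↭-length same ⟩
  length (map reroot (marks T))         ≡⟨ List.length-map reroot (marks T) ⟩
  length (marks T)                      ≡⟨ length-marks T ⟩
  2 ℕ.+ size T                          ≡⟨ cong (2 ℕ.+_) size≡n ⟩
  2 ℕ.+ n                               ∎
  where
  open ≡-Reasoning
  to : ∀ {z} → z ∈ filter (treeᵂ? (embed T)) (candidates n) → z ∈ map reroot (marks T)
  to {z} z∈ with _ , eq ← ∈-filter⁻ (treeᵂ? (embed T)) {xs = candidates n} z∈ =
    subst (_∈ map reroot (marks T)) (reroot-involutive z)
      (∈-map⁺ reroot (∈-marks-of (embed-injective eq)))

  from : ∀ {z} → z ∈ map reroot (marks T) → z ∈ filter (treeᵂ? (embed T)) (candidates n)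
  from z∈ with y , y∈m , refl ← ∈-map⁻ reroot z∈ with refl ← All.lookup (tree-marks T) y∈m =
    ∈-filter⁺ (treeᵂ? (embed T))
      (∈-candidates⁺ (trans (size-tree-reroot y) size≡n , subst (Positive ∘ word) (sym back) pos))
      (cong embed back)
    where
    back : tree (reroot (reroot y)) ≡ tree y
    back = cong tree (reroot-involutive y)

  same : filter (treeᵂ? (embed T)) (candidates n) ↭ map reroot (marks T)
  same = unique∧set⇒↭ (Unique.filter⁺ (treeᵂ? (embed T)) (candidates-unique n))
                      (Unique.map⁺ reroot-injective (marks-unique T)) to from

-- Encodes the star with all labels 1, a witness that the sample space is nonempty, so that the
-- weight below is defined.
comb : ℕ → Blossom
comb ℕ.zero    = leaf
comb (ℕ.suc n) = node mid leaf (comb n)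

size-comb : ∀ n → size (comb n) ≡ n
size-comb ℕ.zero    = refl
size-comb (ℕ.suc n) = cong ℕ.suc (size-comb n)

0<length-candidates : ∀ n → 0 ℕ.< length (candidates n)
0<length-candidates n = ℕ.<-≤-trans (ℕ.s≤s ℕ.z≤n) (begin
  2                                              ≡⟨ #-treeᵁ n (comb n) (size-comb n) ⟨
  (# treeᵁ? (embed (comb n))) (candidates n)     ≤⟨ List.length-filter (treeᵁ? (embed (comb n))) (candidates n) ⟩
  length (candidates n)                          ∎)
  where open ℕ.≤-Reasoning

-- The coupling

module Uniform {Ω : Set} (ωs : List Ω) (0<N : 0 ℕ.< length ωs) where

  0≤n·1 : ∀ n → 0ℚ ℚ.≤ n · 1ℚ
  0≤n·1 ℕ.zero    = ℚ.≤-refl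
  0≤n·1 (ℕ.suc n) = ℚ.+-mono-≤ (ℚ.nonNegative⁻¹ 1ℚ) (0≤n·1 n)

  -- The length as an iterated sum of ones, in the form in which masses arise by adding equal
  -- weights.
  N·1 : ℚ
  N·1 = length ωs · 1ℚ

  0<n·1 : ∀ {n} → 0 ℕ.< n → 0ℚ ℚ.< n · 1ℚ
  0<n·1 {ℕ.suc n} _ = ℚ.+-mono-<-≤ (ℚ.positive⁻¹ 1ℚ) (0≤n·1 n)

  instance
    N·1-positive : ℚ.Positive N·1
    N·1-positive = ℚ.positive (0<n·1 0<N)

    N·1-nonZero : ℚ.NonZero N·1
    N·1-nonZero = ℚ.pos⇒nonZero N·1

  weight : ℚ
  weight = ℚ.1/ N·1

  0≤weight : 0ℚ ℚ.≤ weight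
  0≤weight = ℚ.<⇒≤ (ℚ.positive⁻¹ weight {{ℚ.1/pos⇒pos N·1}})

  mass-filter : (A : Ω → Bool) (xs : List Ω) →
    mass (filter (T? ∘ A ∘ proj₁) (map (_, weight) xs)) ≡ (# (T? ∘ A)) xs · weight
  mass-filter A []       = refl
  mass-filter A (x ∷ xs) with A x
  ... | true  = cong (weight ℚ.+_) (mass-filter A xs)
  ... | false = mass-filter A xs

  N·weight≡1 : length ωs · weight ≡ 1ℚ
  N·weight≡1 = begin
    length ωs · weight            ≡⟨ cong (length ωs ·_) (ℚ.*-identityˡ weight) ⟨
    length ωs · (1ℚ ℚ.* weight)   ≡⟨ ×-assoc-* (length ωs) 1ℚ weight ⟨
    N·1 ℚ.* weight                ≡⟨ ℚ.*-inverseʳ N·1 ⟩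
    1ℚ                            ∎
    where open ≡-Reasoning

  mass-all : (xs : List Ω) → mass (map (_, weight) xs) ≡ length xs · weight
  mass-all []       = refl
  mass-all (x ∷ xs) = cong (weight ℚ.+_) (mass-all xs)

  uniform : Distribution Ω
  uniform = record
    { atoms       = map (_, weight) ωs
    ; nonNegative = All.map⁺ (All.universal (λ _ → 0≤weight) ωs)
    ; total       = trans (mass-all ωs) N·weight≡1
    }

  ℙ-uniform : (A : Ω → Bool) → ℙ uniform A ≡ (# (T? ∘ A)) ωs · weight
  ℙ-uniform A = mass-filter A ωs

  uniformLaw : {B : Set} (_≟_ : DecidableEquality B) (X : Ω → B) (c : ℕ) →
    (∀ x → (# (λ ω → X ω ≟ x)) ωs ≡ c) → HasUniformLaw _≟_ uniform X
  uniformLaw _≟_ X c #≡c x y = trans (law x) (sym (law y))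
    where
    law : ∀ x → ℙ uniform (λ ω → does (X ω ≟ x)) ≡ c · weight
    law x = trans (ℙ-uniform _) (cong (_· weight) (trans (#-does (λ ω → X ω ≟ x) ωs) (#≡c x)))
      where
      #-does : {P : Pred Ω 0ℓ} (P? : Decidable P) → ∀ xs → (# (T? ∘ does ∘ P?)) xs ≡ (# P?) xs
      #-does P? []       = refl
      #-does P? (x ∷ xs) with does (P? x)
      ... | true  = cong ℕ.suc (#-does P? xs)
      ... | false = #-does P? xs

  almostSurely : DecidableEquality Ω → {E : Pred Ω 0ℓ} → All E ωs → AlmostSurely uniform E
  -- The decidable event is membership in the list of outcomes; the property `E` of the theorem
  -- quantifies over all integers.
  almostSurely _≟_ all-E = (λ ω → isYes (member? _≟_ ω ωs)) ,
    trans (ℙ-uniform _)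
      (trans (cong (λ xs → length xs · weight)
               (List.filter-all (T? ∘ (λ ω → isYes (member? _≟_ ω ωs)))
                 (All.tabulate (λ ω∈ → fromWitness ω∈))))
             N·weight≡1) ,
    λ ω t → All.lookup all-E (toWitness t)

module _ {A B : Set} {P : Pred A 0ℓ} (f : ∀ x → P x → B) where

  -- Outcomes carry proofs of admissibility; comparing only the Boolean results of the tests moves a
  -- count back to the bare marks.
  #-reduce : {Q : Pred B 0ℓ} {R : Pred A 0ℓ} (Q? : Decidable Q) (R? : Decidable R) →
             (∀ x (p : P x) → does (Q? (f x p)) ≡ does (R? x)) →
             ∀ {xs} (ps : All P xs) → (# Q?) (All.reduce (λ {x} → f x) ps) ≡ (# R?) xs
  #-reduce Q? R? same []               = refl
  #-reduce Q? R? same (_∷_ {x = x} p ps) with does (Q? (f x p)) | does (R? x) | same x p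
  ... | true  | _ | refl = cong ℕ.suc (#-reduce Q? R? same ps)
  ... | false | _ | refl = #-reduce Q? R? same ps

  length-reduce : ∀ {xs} (ps : All P xs) → length (All.reduce (λ {x} → f x) ps) ≡ length xs
  length-reduce []       = refl
  length-reduce (p ∷ ps) = cong ℕ.suc (length-reduce ps)

  all-reduce : {Q : Pred B 0ℓ} → (∀ x (p : P x) → Q (f x p)) →
               ∀ {xs} (ps : All P xs) → All Q (All.reduce (λ {x} → f x) ps)
  all-reduce q []       = []
  all-reduce q (p ∷ ps) = q _ p ∷ all-reduce q ps

module Coupling (n : ℕ) where

  outcome : ∀ z → Admissible n z → 𝒲 n × 𝒰 n
  outcome z (size≡n , good) =
    wellLabelled (tree (reroot z)) (trans (size-tree-reroot z) size≡n) good , embedded (tree z) size≡n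

  admissible : All (Admissible n) (candidates n)
  admissible = All.all-filter (admissible? n) (concatMap marks (blossoms n))

  outcomes : List (𝒲 n × 𝒰 n)
  outcomes = All.reduce (λ {z} → outcome z) admissible

  open Uniform outcomes
    (subst (0 ℕ.<_) (sym (length-reduce outcome admissible)) (0<length-candidates n)) public

  #-𝒲 : ∀ w → (# (λ ω → proj₁ ω ≟ʷ w)) outcomes ≡ 2 ℕ.+ n
  #-𝒲 w with T , eq , size≡n , pos ← wellLabelled-surjective w = begin
    (# (λ ω → proj₁ ω ≟ʷ w)) outcomes
      -- Equality in `𝒲 n` is decided on the underlying trees, so the two tests return the same
      -- Boolean by computation.
      ≡⟨ #-reduce outcome (λ ω → proj₁ ω ≟ʷ w) (treeᵂ? t) (λ _ _ → refl) admissible ⟩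
    (# treeᵂ? t) (candidates n)         ≡⟨ cong (λ t → (# treeᵂ? t) (candidates n)) eq ⟨
    (# treeᵂ? (embed T)) (candidates n) ≡⟨ #-treeᵂ n T size≡n pos ⟩
    2 ℕ.+ n ∎
    where
    open ≡-Reasoning
    t : Tree
    t = 𝒰.tree (𝒲.embedded w)

  #-𝒰 : ∀ u → (# (λ ω → proj₂ ω ≟ᵘ u)) outcomes ≡ 2
  #-𝒰 u with T , eq , size≡n ← embed-surjective u = begin
    (# (λ ω → proj₂ ω ≟ᵘ u)) outcomes
      ≡⟨ #-reduce outcome (λ ω → proj₂ ω ≟ᵘ u) (treeᵁ? (𝒰.tree u)) (λ _ _ → refl) admissible ⟩
    (# treeᵁ? (𝒰.tree u)) (candidates n) ≡⟨ cong (λ t → (# treeᵁ? t) (candidates n)) eq ⟨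
    (# treeᵁ? (embed T)) (candidates n)  ≡⟨ #-treeᵁ n T size≡n ⟩
    2 ∎
    where open ≡-Reasoning

  isCoupling : IsCoupling uniform
  isCoupling = record
    { uniform-𝒲 = uniformLaw _≟ʷ_ proj₁ (2 ℕ.+ n) #-𝒲
    ; uniform-𝒰 = uniformLaw _≟ᵘ_ proj₂ 2 #-𝒰
    }

  compared-outcomes : All Compared outcomes
  compared-outcomes = all-reduce outcome
    (λ z (size≡n , good) → compared z good size≡n (trans (size-tree-reroot z) size≡n)) admissible

theorem3 : (n : ℕ) → 1 ≤ n →
    Σ[ P ∈ Distribution (𝒲 n × 𝒰 n) ]
    (IsCoupling P ×
    AlmostSurely P (λ (w , u) →
    ((k : ℤ) → (Λ̂ u (k - + 2) ≤ λ̂ w k) × (λ̂ w k ≤ Λ̂ u (k + + 2))) ×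
    (∣ μ w - (M u - m u) ∣ ≤ 3)))
theorem3 n _ = uniform , isCoupling , almostSurely (Product.≡-dec _≟ʷ_ _≟ᵘ_) compared-outcomes
  where open Coupling n
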